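{- For all integers $n\geq 3$, $l\geq 1$ and $0\le k\leq 2l-2$ there exist disjoint point sets $B$ (blue) and $R$ (red) in the plane with $B\cup R$ in general position (no three collinear), $|B|=n+k$, $|R|=l$, such that the vertices of the convex hull of $B\cup R$ are exactly $n$ blue points (so $k$ blue points lie in the interior of $\mathrm{Conv}(B)$), and such that there is no simple polygon with vertex set exactly $B$ having all red points in its exterior.
   Context: $\mathrm{Conv}(X)$ denotes the convex hull of $X$. -}

module Defs where

open import Data.Nat as ℕ using (ℕ; zero; suc; NonZero)
open import Data.Nat.DivMod using (_mod_)
open import Data.Fin using (Fin; zero; suc; toℕ)
open import Data.Integer as ℤ using (ℤ)
open import Data.Rational using (ℚ; 0ℚ; 1ℚ; _+_; _*_; _-_; _≤_; _<_; _≤?_; _<?_)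
open import Data.Product using (Σ; ∃; _×_; _,_; proj₁; proj₂)
open import Data.Sum using (_⊎_)
open import Data.Bool using (Bool; true; false; if_then_else_; _∧_)
open import Relation.Nullary using (¬_; does)
open import Relation.Binary.PropositionalEquality using (_≡_; _≢_)
open import Function.Definitions using (Injective)

Point : Set
Point = ℚ × ℚ

sumF : {m : ℕ} → (Fin m → ℚ) → ℚ
sumF {zero} f = 0ℚ
sumF {suc m} f = f zero + sumF (λ i → f (suc i))

orient : Point → Point → Point → ℚ
orient (px , py) (qx , qy) (rx , ry) = (qx - px) * (ry - py) - (qy - py) * (rx - px)

GeneralPosition : {m : ℕ} → (Fin m → Point) → Set
GeneralPosition {m} P = ∀ (i j k : Fin m) → i ≢ j → j ≢ k → i ≢ k → orient (P i) (P j) (P k) ≢ 0ℚ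

InConvWithout : {m : ℕ} → (Fin m → Point) → Point → Set
InConvWithout {m} P x =
  Σ (Fin m → ℚ) λ w →
    (∀ j → 0ℚ ≤ w j) ×
    (∀ j → P j ≡ x → w j ≡ 0ℚ) ×
    sumF w ≡ 1ℚ ×
    sumF (λ j → w j * proj₁ (P j)) ≡ proj₁ x ×
    sumF (λ j → w j * proj₂ (P j)) ≡ proj₂ x

IsHullVertex : {m : ℕ} → (Fin m → Point) → Point → Set
IsHullVertex P x = (∃ λ i → P i ≡ x) × ¬ InConvWithout P x

csucc : {m : ℕ} → Fin (suc m) → Fin (suc m)
csucc {m} i = suc (toℕ i) mod suc m

OnSeg : Point → Point → Point → Set
OnSeg (ax , ay) (bx , by) (x , y) =
  Σ ℚ λ s → 0ℚ ≤ s × s ≤ 1ℚ × ax + s * (bx - ax) ≡ x × ay + s * (by - ay) ≡ y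

OnEdge : {m : ℕ} → (Fin (suc m) → Point) → Fin (suc m) → Point → Set
OnEdge v i x = OnSeg (v i) (v (csucc i)) x

SimplePolygon : {m : ℕ} → (Fin (suc m) → Point) → Set
SimplePolygon {m} v =
  Injective _≡_ _≡_ v ×
  (∀ (i j : Fin (suc m)) → i ≢ j → ∀ x → OnEdge v i x → OnEdge v j x →
     (j ≡ csucc i × x ≡ v j) ⊎ (i ≡ csucc j × x ≡ v i))

-- Signed crossing contribution of the directed edge a → b to the winding
-- number around x (standard exact winding-number rule with the ray going
-- in the +x direction from x).
crossing : Point → Point → Point → ℤ
crossing a b x =
  if does (proj₂ a ≤? proj₂ x) ∧ does (proj₂ x <? proj₂ b) ∧ does (0ℚ <? orient a b x)
  then ℤ.+ 1
  else if does (proj₂ b ≤? proj₂ x) ∧ does (proj₂ x <? proj₂ a) ∧ does (orient a b x <? 0ℚ)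
  then ℤ.- (ℤ.+ 1)
  else ℤ.+ 0

sumZ : {m : ℕ} → (Fin m → ℤ) → ℤ
sumZ {zero} f = ℤ.+ 0
sumZ {suc m} f = f zero ℤ.+ sumZ (λ i → f (suc i))

winding : {m : ℕ} → (Fin (suc m) → Point) → Point → ℤ
winding v x = sumZ (λ i → crossing (v i) (v (csucc i)) x)

-- x lies in the exterior of the polygon v: not on its boundary and
-- winding number zero (the unbounded complementary component).
InExterior : {m : ℕ} → (Fin (suc m) → Point) → Point → Set
InExterior v x = (∀ i → ¬ OnEdge v i x) × winding v x ≡ ℤ.+ 0

module Submission where

-- Place the red points along a nearly horizontal line.  The "lower" blue points (the hull vertices west
-- and east and half of the inner points) lie below it, separated from each other by the red points.  The
-- "upper" ones (the other hull vertices, far up, and the other inner points, which lie further east) are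
-- so high that an edge from an upper to a lower point meets the line in the gap of its lower end.  If all red points are outside a polygon, then the polygon crosses each gap
-- equally often in both directions, so the two neighbours of a lower vertex are both upper or both
-- lower; since upper vertices exist, they are both upper.  Edges do not cross, so the neighbours of the
-- lower vertices, taken from west to east, move east.  The two neighbours of west are not both hull vertices
-- (one of the edges would be a chord of the hull, separating the others), so one of them is an inner upper
-- point, and from there each lower vertex needs a further inner upper point: there are too few of them.

-- The bound on `k` counts gaps twice: the red points leave one gap fewer than their number, each
-- gap holds at most one lower inner point, and there are at most as many upper inner points as
-- lower ones. The induction along the lower vertices consumes one upper inner point for `west` and
-- a new one for each lower inner point, so it asks for more than there are. The balance of a gap
-- comes from winding numbers. Summed by vertices, the winding number around a red point is a sum
-- over the lower vertices east of it, each weighted by the difference in kind of its two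
-- neighbours. Subtracting the sums of two consecutive red points leaves the one lower vertex
-- between them. The gaps of `west` and `east` have a red point on one side only; on the other side
-- the sum vanishes for every closed polygon. Balance alone allows two lower neighbours. To exclude
-- this, the property "lower and followed by lower" is passed around the whole polygon, which takes
-- balance at every lower vertex, `east` included. As `n`, `l` and `k` are arbitrary, the
-- coordinates are integers given by formulas that reduce every orientation to an inequality between
-- natural numbers.

open import Defs
open import Data.Product using (Σ; ∃; _×_; _,_; proj₁; proj₂)
open import Data.Sum using (_⊎_; inj₁; inj₂; [_,_]′)
open import Data.Empty using (⊥; ⊥-elim)
open import Function using (_∘_)
open import Relation.Nullary using (¬_; Dec; yes; no; does; contradiction)
open import Relation.Binary.PropositionalEquality

-- Orientations and crossing segments in the rational plane.

module Orientation where

  open import Data.Nat using (zero; suc)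
  open import Data.Fin using (Fin; zero; suc)
  open import Data.Rational using (ℚ; 0ℚ; 1ℚ; _+_; _*_; _-_; -_; _≤_; _<_; 1/_; NonZero; Positive; positive; nonNegative)
  open import Data.Rational.Properties
  open import Data.Rational.Solver
  open +-*-Solver

  CCW : Point → Point → Point → Set
  CCW P Q R = 0ℚ < orient P Q R

  orient-rotate : ∀ P Q R → orient P Q R ≡ orient Q R P
  orient-rotate (a , b) (c , d) (e , f) = solve 6 (λ a b c d e f →
    (c :- a) :* (f :- b) :- (d :- b) :* (e :- a) := (e :- c) :* (b :- d) :- (f :- d) :* (a :- c)) refl a b c d e f

  orient-swap : ∀ P Q R → orient P Q R ≡ - orient Q P R
  orient-swap (a , b) (c , d) (e , f) = solve 6 (λ a b c d e f →
    (c :- a) :* (f :- b) :- (d :- b) :* (e :- a) := :- ((a :- c) :* (f :- d) :- (b :- d) :* (e :- c))) refl a b c d e f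

  orient-degenerate : ∀ P Q → orient P Q P ≡ 0ℚ
  orient-degenerate (a , b) (c , d) = solve 4 (λ a b c d →
    (c :- a) :* (b :- b) :- (d :- b) :* (a :- a) := con 0ℚ) refl a b c d

  CCW-rotate : ∀ P Q R → CCW P Q R → CCW Q R P
  CCW-rotate P Q R = subst (0ℚ <_) (orient-rotate P Q R)

  reciprocal : ∀ d → 0ℚ < d → ∃ λ i → 0ℚ ≤ i × d * i ≡ 1ℚ
  reciprocal d d>0 = 1/ d , <⇒≤ (positive⁻¹ (1/ d)) , *-inverseʳ d
    where instance
      pos : Positive d
      pos = positive d>0
      nz : NonZero d
      nz = pos⇒nonZero d
      ipos : Positive (1/ d)
      ipos = 1/pos⇒pos d

  *-nonNeg : ∀ {a b} → 0ℚ ≤ a → 0ℚ ≤ b → 0ℚ ≤ a * b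
  *-nonNeg {a} {b} 0≤a 0≤b = nonNegative⁻¹ (a * b) {{nonNeg*nonNeg⇒nonNeg a {{nonNegative 0≤a}} b {{nonNegative 0≤b}}}}

  +-nonNeg : ∀ {a b} → 0ℚ ≤ a → 0ℚ ≤ b → 0ℚ ≤ a + b
  +-nonNeg = +-mono-≤

  fraction≤1 : ∀ a b i → 0ℚ ≤ b → 0ℚ ≤ i → (a + b) * i ≡ 1ℚ → a * i ≤ 1ℚ
  fraction≤1 a b i 0≤b 0≤i eq = subst₂ _≤_ (+-identityʳ (a * i)) (trans (sym (*-distribʳ-+ i a b)) eq)
                                  (+-monoʳ-≤ (a * i) (*-nonNeg 0≤b 0≤i))

  -- Clears the denominator `D`, so that equality of two such points becomes a polynomial identity.
  interpolate : ∀ p a d D i → D * i ≡ 1ℚ → p + (a * i) * d ≡ i * (D * p + a * d)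
  interpolate p a d D i eq = begin
    p + (a * i) * d             ≡⟨ cong (_+ (a * i) * d) (sym (*-identityˡ p)) ⟩
    1ℚ * p + (a * i) * d        ≡⟨ cong (λ z → z * p + (a * i) * d) (sym eq) ⟩
    (D * i) * p + (a * i) * d   ≡⟨ solve 5 (λ p a d D i → (D :* i) :* p :+ (a :* i) :* d := i :* (D :* p :+ a :* d))
      refl p a d D i ⟩
    i * (D * p + a * d) ∎
    where open ≡-Reasoning

  -- The hypotheses put `R` and `S` on opposite sides of the line `PQ`, and `P` and `Q` on opposite
  -- sides of `RS`. By Cramer's rule the parameters of the common point are quotients of
  -- orientations with denominator `Δ`.
  segments-cross : ∀ P Q R S → CCW P Q R → CCW Q P S → CCW R S Q → CCW S R P →
                   ∃ λ X → OnSeg P Q X × OnSeg R S X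
  segments-cross P@(px , py) Q@(qx , qy) R@(rx , ry) S@(sx , sy) pqr qps rsq srp =
    (px + t * (qx - px) , py + t * (qy - py)) ,
    (t , *-nonNeg (<⇒≤ srp) 0≤i , fraction≤1 (orient S R P) _ i (<⇒≤ rsq) 0≤i
      (trans (cong (_* i) (sym Δ≡)) Δi) , refl , refl) ,
    (s , *-nonNeg (<⇒≤ pqr) 0≤i , fraction≤1 (orient P Q R) _ i (<⇒≤ qps) 0≤i Δi ,
     trans (interpolate rx (orient P Q R) (sx - rx) Δ i Δi)
       (trans (cong (i *_) (sym x≡)) (sym (interpolate px (orient S R P) (qx - px) Δ i Δi))) ,
     trans (interpolate ry (orient P Q R) (sy - ry) Δ i Δi)
       (trans (cong (i *_) (sym y≡)) (sym (interpolate py (orient S R P) (qy - py) Δ i Δi))))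
    where
    Δ = orient P Q R + orient Q P S
    inv = reciprocal Δ (+-mono-< pqr qps)
    i = proj₁ inv
    0≤i = proj₁ (proj₂ inv)
    Δi = proj₂ (proj₂ inv)
    t = orient S R P * i
    s = orient P Q R * i

    O : ∀ {n} → Polynomial n → Polynomial n → Polynomial n → Polynomial n → Polynomial n → Polynomial n → Polynomial n
    O a b c d e f = (c :- a) :* (f :- b) :- (d :- b) :* (e :- a)

    -- Either diagonal of the quadrilateral `P S Q R` cuts it into two triangles; both sides are
    -- twice its area.
    Δ≡ : Δ ≡ orient S R P + orient R S Q
    Δ≡ = solve 8 (λ px py qx qy rx ry sx sy →
           O px py qx qy rx ry :+ O qx qy px py sx sy := O sx sy rx ry px py :+ O rx ry sx sy qx qy)
           refl px py qx qy rx ry sx sy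

    x≡ : Δ * px + orient S R P * (qx - px) ≡ Δ * rx + orient P Q R * (sx - rx)
    x≡ = solve 8 (λ px py qx qy rx ry sx sy →
           (O px py qx qy rx ry :+ O qx qy px py sx sy) :* px :+ O sx sy rx ry px py :* (qx :- px)
           := (O px py qx qy rx ry :+ O qx qy px py sx sy) :* rx :+ O px py qx qy rx ry :* (sx :- rx))
           refl px py qx qy rx ry sx sy

    y≡ : Δ * py + orient S R P * (qy - py) ≡ Δ * ry + orient P Q R * (sy - ry)
    y≡ = solve 8 (λ px py qx qy rx ry sx sy →
           (O px py qx qy rx ry :+ O qx qy px py sx sy) :* py :+ O sx sy rx ry px py :* (qy :- py)
           := (O px py qx qy rx ry :+ O qx qy px py sx sy) :* ry :+ O px py qx qy rx ry :* (sy :- ry))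
           refl px py qx qy rx ry sx sy

  OnSeg-sym : ∀ P Q X → OnSeg P Q X → OnSeg Q P X
  OnSeg-sym (px , py) (qx , qy) _ (s , 0≤s , s≤1 , refl , refl) =
    1ℚ - s , subst (_≤ 1ℚ - s) (+-inverseʳ s) (+-monoˡ-≤ (- s) s≤1) , subst (1ℚ - s ≤_) (+-identityʳ 1ℚ)
      (+-monoʳ-≤ 1ℚ (neg-antimono-≤ 0≤s)) , flip px qx , flip py qy
    where
    flip : ∀ p q → q + (1ℚ - s) * (p - q) ≡ p + s * (q - p)
    flip p q = solve 3 (λ p q s → q :+ (con 1ℚ :- s) :* (p :- q) := p :+ s :* (q :- p)) refl p q s

  -- Convex combinations: certificates for being and for not being a hull vertex.

  sumF-cong : ∀ {m} {f g : Fin m → ℚ} → (∀ i → f i ≡ g i) → sumF f ≡ sumF g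
  sumF-cong {zero} f≗g = refl
  sumF-cong {suc m} f≗g = cong₂ _+_ (f≗g zero) (sumF-cong (f≗g ∘ suc))

  sumF-+ : ∀ m (f g : Fin m → ℚ) → sumF (λ i → f i + g i) ≡ sumF f + sumF g
  sumF-+ zero f g = refl
  sumF-+ (suc m) f g = trans (cong (f zero + g zero +_) (sumF-+ m (f ∘ suc) (g ∘ suc)))
    (solve 4 (λ a b c d → (a :+ b) :+ (c :+ d) := (a :+ c) :+ (b :+ d)) refl (f zero) (g zero) (sumF (f ∘ suc))
      (sumF (g ∘ suc)))

  sumF-* : ∀ m c (f : Fin m → ℚ) → sumF (λ i → c * f i) ≡ c * sumF f
  sumF-* zero c f = sym (*-zeroʳ c)
  sumF-* (suc m) c f = trans (cong (c * f zero +_) (sumF-* m c (f ∘ suc))) (sym (*-distribˡ-+ c _ _))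

  sumF-0 : ∀ m → sumF {m} (λ _ → 0ℚ) ≡ 0ℚ
  sumF-0 zero = refl
  sumF-0 (suc m) = trans (+-identityˡ _) (sumF-0 m)

  sumF-nonNeg : ∀ {m} {f : Fin m → ℚ} → (∀ i → 0ℚ ≤ f i) → 0ℚ ≤ sumF f
  sumF-nonNeg {zero} f≥0 = ≤-refl
  sumF-nonNeg {suc m} f≥0 = +-mono-≤ (f≥0 zero) (sumF-nonNeg (f≥0 ∘ suc))

  sumF-zero-terms : ∀ {m} {f : Fin m → ℚ} → (∀ i → 0ℚ ≤ f i) → sumF f ≡ 0ℚ → ∀ i → f i ≡ 0ℚ
  sumF-zero-terms {suc m} {f} f≥0 Σ≡0 = λ where
      zero    → ≤-antisym (subst₂ _≤_ (+-identityʳ _) Σ≡0 (+-monoʳ-≤ (f zero) (sumF-nonNeg (f≥0 ∘ suc)))) (f≥0 zero)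
      (suc i) → sumF-zero-terms (f≥0 ∘ suc) tail≡0 i
    where
    tail≡0 : sumF (f ∘ suc) ≡ 0ℚ
    tail≡0 = ≤-antisym (subst₂ _≤_ (+-identityˡ _) Σ≡0 (+-monoˡ-≤ _ (f≥0 zero))) (sumF-nonNeg (f≥0 ∘ suc))

  δ : ∀ {m} → Fin m → Fin m → ℚ
  δ zero    zero    = 1ℚ
  δ zero    (suc _) = 0ℚ
  δ (suc _) zero    = 0ℚ
  δ (suc i) (suc j) = δ i j

  δ-nonNeg : ∀ {m} (i j : Fin m) → 0ℚ ≤ δ i j
  δ-nonNeg zero    zero    = nonNegative⁻¹ 1ℚ
  δ-nonNeg zero    (suc _) = ≤-refl
  δ-nonNeg (suc _) zero    = ≤-refl
  δ-nonNeg (suc i) (suc j) = δ-nonNeg i j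

  δ-off : ∀ {m} (i j : Fin m) → i ≢ j → δ i j ≡ 0ℚ
  δ-off zero    zero    i≢j = ⊥-elim (i≢j refl)
  δ-off zero    (suc _) _   = refl
  δ-off (suc _) zero    _   = refl
  δ-off (suc i) (suc j) i≢j = δ-off i j (i≢j ∘ cong suc)

  sumF-δ : ∀ {m} (i : Fin m) (f : Fin m → ℚ) → sumF (λ j → δ i j * f j) ≡ f i
  sumF-δ {suc m} zero f = trans (cong₂ _+_ (*-identityˡ (f zero))
    (trans (sumF-cong (λ j → *-zeroˡ (f (suc j)))) (sumF-0 m))) (+-identityʳ _)
  sumF-δ (suc i) f = trans (cong₂ _+_ (*-zeroˡ (f zero)) (sumF-δ i (f ∘ suc))) (+-identityˡ _)

  -- In a convex combination equal to `P i` the weighted deficits of the functional sum to 0 and are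
  -- nonnegative, so each is 0. Hence points with a positive deficit have weight 0; copies of `P i`
  -- have weight 0 by `InConvWithout`; but the weights sum to 1.
  exposed⇒hullVertex : ∀ {m} (P : Fin m → Point) i a b →
    (∀ j → P j ≡ P i ⊎ a * proj₁ (P j) + b * proj₂ (P j) < a * proj₁ (P i) + b * proj₂ (P i)) →
    IsHullVertex P (P i)
  exposed⇒hullVertex {m} P i a b strict = (i , refl) , λ (w , w≥0 , w≡0 , Σw , Σx , Σy) →
    let f = λ j → a * proj₁ (P j) + b * proj₂ (P j)
        slack : Fin m → ℚ
        slack j = w j * (f i - f j)

        slack≥0 : ∀ j → 0ℚ ≤ slack j
        slack≥0 j = *-nonNeg (w≥0 j) (case⊎ (strict j)
          (λ eq → ≤-reflexive (trans (sym (+-inverseʳ (f i)))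
            (cong (λ X → f i - (a * proj₁ X + b * proj₂ X)) (sym eq))))
          (λ lt → subst (_≤ f i - f j) (+-inverseʳ (f j)) (+-monoˡ-≤ (- f j) (<⇒≤ lt))))

        Σslack : sumF slack ≡ 0ℚ
        Σslack = begin
          sumF slack
            ≡⟨ sumF-cong (λ j → solve 6 (λ w c a b x y → w :* (c :- (a :* x :+ b :* y)) := c :* w :+
              ((:- a) :* (w :* x) :+ (:- b) :* (w :* y))) refl (w j) (f i) a b (proj₁ (P j)) (proj₂ (P j))) ⟩
          sumF (λ j → f i * w j + ((- a) * (w j * proj₁ (P j)) + (- b) * (w j * proj₂ (P j))))
            ≡⟨ trans (sumF-+ m _ _) (cong₂ _+_ (sumF-* m (f i) w)
              (trans (sumF-+ m _ _) (cong₂ _+_ (sumF-* m (- a) _) (sumF-* m (- b) _)))) ⟩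
          f i * sumF w + ((- a) * sumF (λ j → w j * proj₁ (P j)) + (- b) * sumF (λ j → w j * proj₂ (P j)))
            ≡⟨ cong₂ _+_ (cong (f i *_) Σw) (cong₂ _+_ (cong (- a *_) Σx) (cong (- b *_) Σy)) ⟩
          f i * 1ℚ + ((- a) * proj₁ (P i) + (- b) * proj₂ (P i))
            ≡⟨ solve 4 (λ a b x y → (a :* x :+ b :* y) :* con 1ℚ :+ ((:- a) :* x :+ (:- b) :* y) := con 0ℚ) refl a b
              (proj₁ (P i)) (proj₂ (P i)) ⟩
          0ℚ ∎

        w-zero : ∀ j → w j ≡ 0ℚ
        w-zero j = case⊎ (strict j) (w≡0 j) λ lt → product-zero (w j) (f i - f j)
          (subst (_< f i - f j) (+-inverseʳ (f j)) (+-monoˡ-< (- f j) lt)) (sumF-zero-terms slack≥0 Σslack j)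
    in 0≢1 (trans (sym (trans (sumF-cong w-zero) (sumF-0 m))) Σw)
    where
    open ≡-Reasoning
    case⊎ : ∀ {A B C : Set} → A ⊎ B → (A → C) → (B → C) → C
    case⊎ (inj₁ x) f g = f x
    case⊎ (inj₂ y) f g = g y
    0≢1 : 0ℚ ≢ 1ℚ
    0≢1 ()
    product-zero : ∀ x y → 0ℚ < y → x * y ≡ 0ℚ → x ≡ 0ℚ
    product-zero x y y>0 eq = let (i , _ , yi) = reciprocal y y>0 in begin
      x            ≡⟨ sym (*-identityʳ x) ⟩
      x * 1ℚ       ≡⟨ cong (x *_) (sym yi) ⟩
      x * (y * i)  ≡⟨ sym (*-assoc x y i) ⟩
      x * y * i    ≡⟨ cong (_* i) eq ⟩
      0ℚ * i       ≡⟨ *-zeroˡ i ⟩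
      0ℚ ∎

  -- The weights are barycentric coordinates, i.e. areas of the three subtriangles at `X` over their
  -- sum. No corner equals `X`, since an orientation with a repeated point is 0, so points equal to
  -- `X` get weight 0.
  inTriangle⇒¬hullVertex : ∀ {m} (P : Fin m → Point) i j k X →
    CCW (P i) (P j) X → CCW (P j) (P k) X → CCW (P k) (P i) X → ¬ IsHullVertex P X
  inTriangle⇒¬hullVertex {m} P i j k X ijX jkX kiX (_ , notInConv) = notInConv (w , w≥0 , w≡0 , Σw ,
      trans (combination proj₁) (barycentric proj₁ bary₁) , trans (combination proj₂) (barycentric proj₂ bary₂))
    where
    open ≡-Reasoning
    A = P i ; B = P j ; C = P k
    T = orient B C X + (orient C A X + orient A B X)
    inv = reciprocal T (+-mono-< jkX (+-mono-< kiX ijX))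
    r = proj₁ inv
    r≥0 = proj₁ (proj₂ inv)
    Tr = proj₂ (proj₂ inv)
    α = orient B C X * r
    β = orient C A X * r
    γ = orient A B X * r

    w : Fin m → ℚ
    w n = α * δ i n + (β * δ j n + γ * δ k n)

    w≥0 : ∀ n → 0ℚ ≤ w n
    w≥0 n = +-nonNeg (term jkX i) (+-nonNeg (term kiX j) (term ijX k))
      where
      term : ∀ {o} → 0ℚ < o → ∀ i → 0ℚ ≤ o * r * δ i n
      term o>0 i = *-nonNeg (*-nonNeg (<⇒≤ o>0) r≥0) (δ-nonNeg i n)

    w≡0 : ∀ n → P n ≡ X → w n ≡ 0ℚ
    w≡0 n refl = begin
      w n                              ≡⟨ cong₂ _+_ (cong (α *_) (δ-off i n i≢n))
        (cong₂ _+_ (cong (β *_) (δ-off j n j≢n)) (cong (γ *_) (δ-off k n k≢n))) ⟩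
      α * 0ℚ + (β * 0ℚ + γ * 0ℚ)       ≡⟨ solve 3 (λ α β γ → α :* con 0ℚ :+ (β :* con 0ℚ :+ γ :* con 0ℚ) := con 0ℚ)
        refl α β γ ⟩
      0ℚ ∎
      where
      distinct : ∀ Q {a} → P a ≡ Q → ∀ R → CCW Q R X → a ≢ n
      distinct Q refl R qrx refl = <-irrefl (sym (orient-degenerate Q R)) qrx
      i≢n : i ≢ n
      i≢n = distinct A refl B ijX
      j≢n : j ≢ n
      j≢n = distinct B refl C jkX
      k≢n : k ≢ n
      k≢n = distinct C refl A kiX

    weigh : ∀ (g : Fin m → ℚ) → sumF (λ n → w n * g n) ≡ α * g i + (β * g j + γ * g k)
    weigh g = begin
      sumF (λ n → w n * g n)
        ≡⟨ sumF-cong (λ n → solve 7 (λ α β γ a b c g → (α :* a :+ (β :* b :+ γ :* c)) :* g := α :* (a :* g) :+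
          (β :* (b :* g) :+ γ :* (c :* g))) refl α β γ (δ i n) (δ j n) (δ k n) (g n)) ⟩
      sumF (λ n → α * (δ i n * g n) + (β * (δ j n * g n) + γ * (δ k n * g n)))
        ≡⟨ trans (sumF-+ m _ _) (cong₂ _+_ (part α i) (trans (sumF-+ m _ _) (cong₂ _+_ (part β j) (part γ k)))) ⟩
      α * g i + (β * g j + γ * g k) ∎
      where
      part : ∀ c i → sumF (λ n → c * (δ i n * g n)) ≡ c * g i
      part c i = trans (sumF-* m c _) (cong (c *_) (sumF-δ i g))

    Σw : sumF w ≡ 1ℚ
    Σw = begin
      sumF w                             ≡⟨ sumF-cong (λ n → sym (*-identityʳ (w n))) ⟩
      sumF (λ n → w n * 1ℚ)              ≡⟨ weigh (λ _ → 1ℚ) ⟩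
      α * 1ℚ + (β * 1ℚ + γ * 1ℚ)         ≡⟨ solve 4
        (λ a b c r → (a :* r) :* con 1ℚ :+ ((b :* r) :* con 1ℚ :+ (c :* r) :* con 1ℚ) := (a :+ (b :+ c)) :* r) refl
          (orient B C X) (orient C A X) (orient A B X) r ⟩
      T * r                              ≡⟨ Tr ⟩
      1ℚ ∎

    combination : ∀ (π : Point → ℚ) → sumF (λ n → w n * π (P n)) ≡ α * π A + (β * π B + γ * π C)
    combination π = weigh (π ∘ P)

    O : ∀ {n} → Polynomial n → Polynomial n → Polynomial n → Polynomial n → Polynomial n → Polynomial n → Polynomial n
    O a b c d e f = (c :- a) :* (f :- b) :- (d :- b) :* (e :- a)

    bary₁ : orient B C X * proj₁ A + (orient C A X * proj₁ B + orient A B X * proj₁ C) ≡ T * proj₁ X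
    bary₁ = solve 8 (λ a b c d e f x y → O c d e f x y :* a :+ (O e f a b x y :* c :+ O a b c d x y :* e)
              := (O c d e f x y :+ (O e f a b x y :+ O a b c d x y)) :* x)
              refl (proj₁ A) (proj₂ A) (proj₁ B) (proj₂ B) (proj₁ C) (proj₂ C) (proj₁ X) (proj₂ X)

    bary₂ : orient B C X * proj₂ A + (orient C A X * proj₂ B + orient A B X * proj₂ C) ≡ T * proj₂ X
    bary₂ = solve 8 (λ a b c d e f x y → O c d e f x y :* b :+ (O e f a b x y :* d :+ O a b c d x y :* f)
              := (O c d e f x y :+ (O e f a b x y :+ O a b c d x y)) :* y)
              refl (proj₁ A) (proj₂ A) (proj₁ B) (proj₂ B) (proj₁ C) (proj₂ C) (proj₁ X) (proj₂ X)

    barycentric : ∀ (π : Point → ℚ) → orient B C X * π A + (orient C A X * π B + orient A B X * π C) ≡ T * π X →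
                  α * π A + (β * π B + γ * π C) ≡ π X
    barycentric π eq = begin
      α * π A + (β * π B + γ * π C)
        ≡⟨ solve 7 (λ a b c r x y z → (a :* r) :* x :+ ((b :* r) :* y :+ (c :* r) :* z) :=
          (a :* x :+ (b :* y :+ c :* z)) :* r) refl (orient B C X) (orient C A X) (orient A B X) r (π A) (π B) (π C) ⟩
      (orient B C X * π A + (orient C A X * π B + orient A B X * π C)) * r
        ≡⟨ cong (_* r) eq ⟩
      T * π X * r
        ≡⟨ solve 3 (λ t x r → t :* x :* r := t :* r :* x) refl T (π X) r ⟩
      T * r * π X
        ≡⟨ cong (_* π X) Tr ⟩
      1ℚ * π X
        ≡⟨ *-identityˡ (π X) ⟩
      π X ∎

open Orientation

-- Sums and induction around a cycle.

module CyclicSums where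

  open import Data.Nat as ℕ using (zero; suc)
  import Data.Nat.Properties as ℕ
  open import Data.Nat.DivMod using (m%n<n; n%n≡0; m<n⇒m%n≡m)
  open import Data.Fin using (Fin; zero; suc; toℕ; fromℕ; inject₁)
  import Data.Fin.Properties as Fin
  open import Data.Fin.Induction using (<-weakInduction; >-weakInduction)
  open import Data.Fin.Relation.Unary.Top using (view; ‵fromℕ; ‵inject₁)
  open import Data.Integer as ℤ using (ℤ; 0ℤ; 1ℤ)
  import Data.Integer.Properties as ℤ
  open import Data.Integer.Tactic.RingSolver using (solve-∀)
  open ≡-Reasoning

  cpred : ∀ {m} → Fin (suc m) → Fin (suc m)
  cpred {m} zero    = fromℕ m
  cpred     (suc i) = inject₁ i

  toℕ-csucc : ∀ {m} (i : Fin (suc m)) → toℕ (csucc i) ≡ suc (toℕ i) ℕ.% suc m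
  toℕ-csucc {m} i = Fin.toℕ-fromℕ< (m%n<n (suc (toℕ i)) (suc m))

  csucc-inject₁ : ∀ {m} (i : Fin m) → csucc (inject₁ i) ≡ suc i
  csucc-inject₁ {m} i = Fin.toℕ-injective (begin
    toℕ (csucc (inject₁ i))             ≡⟨ toℕ-csucc (inject₁ i) ⟩
    suc (toℕ (inject₁ i)) ℕ.% suc m     ≡⟨ cong (λ z → suc z ℕ.% suc m) (Fin.toℕ-inject₁ i) ⟩
    suc (toℕ i) ℕ.% suc m               ≡⟨ m<n⇒m%n≡m (ℕ.s<s (Fin.toℕ<n i)) ⟩
    suc (toℕ i) ∎)

  csucc-fromℕ : ∀ m → csucc (fromℕ m) ≡ zero
  csucc-fromℕ m = Fin.toℕ-injective (begin
    toℕ (csucc (fromℕ m))           ≡⟨ toℕ-csucc (fromℕ m) ⟩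
    suc (toℕ (fromℕ m)) ℕ.% suc m   ≡⟨ cong (λ z → suc z ℕ.% suc m) (Fin.toℕ-fromℕ m) ⟩
    suc m ℕ.% suc m                 ≡⟨ n%n≡0 (suc m) ⟩
    0 ∎)

  csucc-cpred : ∀ {m} (i : Fin (suc m)) → csucc (cpred i) ≡ i
  csucc-cpred {m} zero = csucc-fromℕ m
  csucc-cpred (suc i)  = csucc-inject₁ i

  cpred-csucc : ∀ {m} (i : Fin (suc m)) → cpred (csucc i) ≡ i
  cpred-csucc {m} i with view i
  ... | ‵fromℕ     = cong cpred (csucc-fromℕ m)
  ... | ‵inject₁ j = cong cpred (csucc-inject₁ j)

  csucc≢cpred : ∀ {m} (i : Fin (suc (suc (suc m)))) → csucc i ≢ cpred i
  csucc≢cpred zero eq with () ← trans (sym (csucc-inject₁ zero)) eq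
  csucc≢cpred {m} (suc i) eq with view i
  ... | ‵fromℕ with () ← trans (sym (csucc-fromℕ (suc (suc m)))) eq
  ... | ‵inject₁ j = ℕ.m≢1+n+m (toℕ j) {1} (begin
    toℕ j                           ≡⟨ trans (Fin.toℕ-inject₁ _) (Fin.toℕ-inject₁ j) ⟨
    toℕ (inject₁ (inject₁ j))       ≡⟨ cong toℕ eq ⟨
    toℕ (csucc (suc (inject₁ j)))   ≡⟨ cong toℕ (csucc-inject₁ (suc j)) ⟩
    toℕ (suc (suc j)) ∎)

  -- Induction upwards from `i` reaches the last index; one step wraps around to `zero`, from where
  -- ordinary induction covers everything.
  csucc-closed : ∀ {m} (P : Fin (suc m) → Set) → (∀ i → P i → P (csucc i)) → ∀ {i} → P i → ∀ j → P j
  csucc-closed {m} P step {i} Pi = <-weakInduction P (subst P (csucc-fromℕ m) (step _ P-last)) up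
    where
    up : ∀ j → P (inject₁ j) → P (suc j)
    up j = subst P (csucc-inject₁ j) ∘ step (inject₁ j)
    P-last : P (fromℕ m)
    P-last = >-weakInduction (λ j → P j → P (fromℕ m)) (λ p → p) (λ j ih → ih ∘ up j) i Pi

  cpred-closed : ∀ {m} (P : Fin (suc m) → Set) → (∀ i → P i → P (cpred i)) → ∀ {i} → P i → ∀ j → P j
  cpred-closed {m} P step {i} Pi = >-weakInduction P (step zero P-zero) (step ∘ suc)
    where
    P-zero : P zero
    P-zero = <-weakInduction (λ j → P j → P zero) (λ p → p) (λ j ih → ih ∘ step (suc j)) i Pi

  sumZ-cong : ∀ {m} {f g : Fin m → ℤ} → (∀ i → f i ≡ g i) → sumZ f ≡ sumZ g
  sumZ-cong {zero}  f≗g = refl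
  sumZ-cong {suc m} f≗g = cong₂ ℤ._+_ (f≗g zero) (sumZ-cong (f≗g ∘ suc))

  sumZ-- : ∀ m (f g : Fin m → ℤ) → sumZ (λ i → f i ℤ.- g i) ≡ sumZ f ℤ.- sumZ g
  sumZ-- zero    f g = refl
  sumZ-- (suc m) f g = trans (cong (λ z → (f zero ℤ.- g zero) ℤ.+ z) (sumZ-- m (f ∘ suc) (g ∘ suc)))
    (interchange (f zero) (g zero) (sumZ (f ∘ suc)) (sumZ (g ∘ suc)))
    where
    interchange : ∀ a b c d → (a ℤ.- b) ℤ.+ (c ℤ.- d) ≡ (a ℤ.+ c) ℤ.- (b ℤ.+ d)
    interchange = solve-∀

  sumZ-0 : ∀ m {f : Fin m → ℤ} → (∀ i → f i ≡ 0ℤ) → sumZ f ≡ 0ℤ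
  sumZ-0 zero    f≗0 = refl
  sumZ-0 (suc m) f≗0 = cong₂ ℤ._+_ (f≗0 zero) (sumZ-0 m (f≗0 ∘ suc))

  sumZ-single : ∀ {m} (p : Fin m) {f : Fin m → ℤ} → (∀ i → i ≢ p → f i ≡ 0ℤ) → sumZ f ≡ f p
  sumZ-single {suc m} zero    {f} off = trans (cong (λ z → f zero ℤ.+ z) (sumZ-0 m λ i → off (suc i) λ ()))
    (ℤ.+-identityʳ _)
  sumZ-single {suc m} (suc p) {f} off = trans (cong₂ ℤ._+_ (off zero λ ())
    (sumZ-single p λ i i≢p → off (suc i) (i≢p ∘ Fin.suc-injective)))
                                     (ℤ.+-identityˡ _)

  sumZ-last : ∀ m (f : Fin (suc m) → ℤ) → sumZ f ≡ sumZ (f ∘ inject₁) ℤ.+ f (fromℕ m)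
  sumZ-last zero    f = ℤ.+-comm (f zero) 0ℤ
  sumZ-last (suc m) f = trans (cong (λ z → f zero ℤ.+ z) (sumZ-last m (f ∘ suc))) (sym (ℤ.+-assoc (f zero) _ _))

  sumZ-rotate : ∀ {m} (f : Fin (suc m) → ℤ) → sumZ (f ∘ csucc) ≡ sumZ f
  sumZ-rotate {m} f = begin
    sumZ (f ∘ csucc)                                       ≡⟨ sumZ-last m (f ∘ csucc) ⟩
    sumZ (f ∘ csucc ∘ inject₁) ℤ.+ f (csucc (fromℕ m))     ≡⟨ cong₂ ℤ._+_ (sumZ-cong (cong f ∘ csucc-inject₁))
      (cong f (csucc-fromℕ m)) ⟩
    sumZ (f ∘ suc) ℤ.+ f zero                              ≡⟨ ℤ.+-comm (sumZ (f ∘ suc)) (f zero) ⟩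
    sumZ f ∎

  -- With f the indicator of the lower vertices east of a point and g that of the upper
  -- vertices, this is the winding number around the point.
  flow : ∀ {m} → (f g : Fin (suc m) → ℤ) → ℤ
  flow f g = sumZ (λ i → f i ℤ.* g (csucc i) ℤ.- f (csucc i) ℤ.* g i)

  -- Summation by parts: a vertex occurs as the start of one edge and as the end of another, with
  -- opposite signs.
  flow-by-vertices : ∀ {m} (f g : Fin (suc m) → ℤ) → flow f g ≡ sumZ (λ i → f i ℤ.* (g (csucc i) ℤ.- g (cpred i)))
  flow-by-vertices {m} f g = begin
    flow f g
      ≡⟨ sumZ-- (suc m) (λ i → f i ℤ.* g (csucc i)) (λ i → f (csucc i) ℤ.* g i) ⟩
    sumZ (λ i → f i ℤ.* g (csucc i)) ℤ.- sumZ (λ i → f (csucc i) ℤ.* g i)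
      ≡⟨ cong (λ z → sumZ (λ i → f i ℤ.* g (csucc i)) ℤ.- z)
           (trans (sumZ-cong (λ i → cong (λ j → f (csucc i) ℤ.* g j) (sym (cpred-csucc i))))
                  (sumZ-rotate (λ i → f i ℤ.* g (cpred i)))) ⟩
    sumZ (λ i → f i ℤ.* g (csucc i)) ℤ.- sumZ (λ i → f i ℤ.* g (cpred i))
      ≡⟨ sumZ-- (suc m) (λ i → f i ℤ.* g (csucc i)) (λ i → f i ℤ.* g (cpred i)) ⟨
    sumZ (λ i → f i ℤ.* g (csucc i) ℤ.- f i ℤ.* g (cpred i))
      ≡⟨ sumZ-cong (λ i → factor (f i) (g (csucc i)) (g (cpred i))) ⟩
    sumZ (λ i → f i ℤ.* (g (csucc i) ℤ.- g (cpred i))) ∎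
    where
    factor : ∀ a b c → a ℤ.* b ℤ.- a ℤ.* c ≡ a ℤ.* (b ℤ.- c)
    factor = solve-∀

  -- The summands become differences of consecutive values of `g` and telescope. This stands in for
  -- a winding number around a point west of all lower vertices.
  flow-complement : ∀ {m} (f g : Fin (suc m) → ℤ) → (∀ i → f i ≡ 1ℤ ℤ.- g i) → flow f g ≡ 0ℤ
  flow-complement {m} f g f≡1-g = begin
    flow f g                                  ≡⟨ sumZ-cong
      (λ i → trans (cong₂ (λ a b → a ℤ.* g (csucc i) ℤ.- b ℤ.* g i) (f≡1-g i) (f≡1-g (csucc i)))
        (cancel (g i) (g (csucc i)))) ⟩
    sumZ (λ i → g (csucc i) ℤ.- g i)          ≡⟨ sumZ-- (suc m) (g ∘ csucc) g ⟩
    sumZ (g ∘ csucc) ℤ.- sumZ g               ≡⟨ cong (ℤ._- sumZ g) (sumZ-rotate g) ⟩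
    sumZ g ℤ.- sumZ g                         ≡⟨ ℤ.+-inverseʳ (sumZ g) ⟩
    0ℤ ∎
    where
    cancel : ∀ a b → (1ℤ ℤ.- a) ℤ.* b ℤ.- (1ℤ ℤ.- b) ℤ.* a ≡ b ℤ.- a
    cancel = solve-∀

  -- In the difference of the two sums by vertices only the term at `p` survives.
  flow-isolates : ∀ {m} (f f′ g : Fin (suc m) → ℤ) p → flow f g ≡ 0ℤ → flow f′ g ≡ 0ℤ →
                  (∀ i → i ≢ p → f i ≡ f′ i) → f p ≡ 1ℤ ℤ.+ f′ p → g (csucc p) ≡ g (cpred p)
  flow-isolates {m} f f′ g p flow≡0 flow′≡0 off at = ℤ.i-j≡0⇒i≡j _ _ (begin
    φ p                                              ≡⟨ one-more (f′ p) (φ p) ⟩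
    (1ℤ ℤ.+ f′ p) ℤ.* φ p ℤ.- f′ p ℤ.* φ p           ≡⟨ cong (λ z → z ℤ.* φ p ℤ.- f′ p ℤ.* φ p) at ⟨
    f p ℤ.* φ p ℤ.- f′ p ℤ.* φ p                     ≡⟨ sumZ-single p
      (λ i i≢p → trans (cong (λ z → z ℤ.* φ i ℤ.- f′ i ℤ.* φ i) (off i i≢p)) (ℤ.+-inverseʳ (f′ i ℤ.* φ i))) ⟨
    sumZ (λ i → f i ℤ.* φ i ℤ.- f′ i ℤ.* φ i)        ≡⟨ sumZ-- (suc m) (λ i → f i ℤ.* φ i) (λ i → f′ i ℤ.* φ i) ⟩
    sumZ (λ i → f i ℤ.* φ i) ℤ.- sumZ (λ i → f′ i ℤ.* φ i)
      ≡⟨ cong₂ ℤ._-_ (trans (sym (flow-by-vertices f g)) flow≡0) (trans (sym (flow-by-vertices f′ g)) flow′≡0) ⟩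
    0ℤ ∎)
    where
    φ : Fin (suc m) → ℤ
    φ i = g (csucc i) ℤ.- g (cpred i)
    one-more : ∀ a b → b ≡ (1ℤ ℤ.+ a) ℤ.* b ℤ.- a ℤ.* b
    one-more = solve-∀

open CyclicSums

open import Data.Nat as ℕ using (ℕ; zero; suc; z≤n; s≤s; _+_; _*_; _∸_; _≤_; _<_)
import Data.Nat.Properties as ℕ
open import Data.Integer as ℤ using (ℤ; 0ℤ; 1ℤ; -1ℤ; +_; -[1+_]; ∣_∣)
import Data.Integer.Properties as ℤ
open import Data.Integer.Tactic.RingSolver using (solve-∀)
open import Data.Rational as ℚ using (ℚ; 0ℚ)
import Data.Rational.Properties as ℚ
open import Data.Rational.Literals using (fromℤ)
open import Data.Bool using (Bool; true; false; if_then_else_; _∧_)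
open import Data.Fin as Fin using (Fin; toℕ; splitAt; _↑ˡ_)
import Data.Fin.Properties as Fin
open import Data.Fin.Permutation using (Permutation′; _⟨$⟩ʳ_; _⟨$⟩ˡ_; inverseˡ; inverseʳ)
open import Data.Vec.Functional using (_++_)
open import Data.Vec.Functional.Properties using (lookup-++ˡ)
open import Relation.Nullary.Decidable using (dec-true; dec-false)
open import Relation.Binary.Definitions using (Tri; tri<; tri≈; tri>)
open import Function.Definitions using (Injective)
open import Function.Bundles using (_⇔_; mk⇔)

-- Integer points, and orientations decided by levels.

fromℤ-+ : ∀ a b → fromℤ a ℚ.+ fromℤ b ≡ fromℤ (a ℤ.+ b)
fromℤ-+ a b = trans (cong (ℚ._/ 1) (cong₂ ℤ._+_ (ℤ.*-identityʳ a) (ℤ.*-identityʳ b))) (ℚ.↥p/↧p≡p (fromℤ (a ℤ.+ b)))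

fromℤ-* : ∀ a b → fromℤ a ℚ.* fromℤ b ≡ fromℤ (a ℤ.* b)
fromℤ-* a b = ℚ.↥p/↧p≡p (fromℤ (a ℤ.* b))

fromℤ-neg : ∀ a → ℚ.- fromℤ a ≡ fromℤ (ℤ.- a)
fromℤ-neg (+ zero)  = refl
fromℤ-neg (+ suc _) = refl
fromℤ-neg -[1+ _ ]  = refl

fromℤ-- : ∀ a b → fromℤ a ℚ.- fromℤ b ≡ fromℤ (a ℤ.- b)
fromℤ-- a b = trans (cong (fromℤ a ℚ.+_) (fromℤ-neg b)) (fromℤ-+ a (ℤ.- b))

fromℤ-mono-< : ∀ {a b} → a ℤ.< b → fromℤ a ℚ.< fromℤ b
fromℤ-mono-< {a} {b} a<b = ℚ.*<* (subst₂ ℤ._<_ (sym (ℤ.*-identityʳ a)) (sym (ℤ.*-identityʳ b)) a<b)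

orientℤ : ℤ × ℤ → ℤ × ℤ → ℤ × ℤ → ℤ
orientℤ (px , py) (qx , qy) (rx , ry) = (qx ℤ.- px) ℤ.* (ry ℤ.- py) ℤ.- (qy ℤ.- py) ℤ.* (rx ℤ.- px)

fromℤ² : ℤ × ℤ → Point
fromℤ² (x , y) = fromℤ x , fromℤ y

orient-fromℤ : ∀ P Q R → orient (fromℤ² P) (fromℤ² Q) (fromℤ² R) ≡ fromℤ (orientℤ P Q R)
orient-fromℤ (px , py) (qx , qy) (rx , ry) =
  trans (cong₂ ℚ._-_ (product qx px ry py) (product qy py rx px)) (fromℤ-- ((qx ℤ.- px) ℤ.* (ry ℤ.- py)) _)
  where
  product : ∀ a b c d → (fromℤ a ℚ.- fromℤ b) ℚ.* (fromℤ c ℚ.- fromℤ d) ≡ fromℤ ((a ℤ.- b) ℤ.* (c ℤ.- d))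
  product a b c d = trans (cong₂ ℚ._*_ (fromℤ-- a b) (fromℤ-- c d)) (fromℤ-* (a ℤ.- b) (c ℤ.- d))

∣m-n∣≤ : ∀ {m n N} → m ≤ N → n ≤ N → ∣ + m ℤ.- + n ∣ ≤ N
∣m-n∣≤ {m} {n} m≤N n≤N = subst (λ z → ∣ z ∣ ≤ _) (sym (ℤ.m-n≡m⊖n m n)) (ℕ.≤-trans (ℤ.∣m⊝n∣≤m⊔n m n) (ℕ.⊔-lub m≤N n≤N))

i≤∣i∣ : ∀ i → i ℤ.≤ + ∣ i ∣
i≤∣i∣ (+ n)    = ℤ.≤-refl
i≤∣i∣ -[1+ n ] = ℤ.-≤+

pos-*+* : ∀ a b c d → + (a * b + c * d) ≡ + a ℤ.* + b ℤ.+ + c ℤ.* + d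
pos-*+* a b c d = trans (ℤ.pos-+ (a * b) _) (cong₂ ℤ._+_ (ℤ.pos-* a b) (ℤ.pos-* c d))

∸-cast : ∀ {m n} → m ≤ n → + (n ∸ m) ≡ + n ℤ.- + m
∸-cast {m} {n} m≤n = sym (trans (ℤ.m-n≡m⊖n n m) (ℤ.⊖-≥ m≤n))

functional : ℤ → ℤ → Point → ℚ
functional a b P = fromℤ a ℚ.* proj₁ P ℚ.+ fromℤ b ℚ.* proj₂ P

-- Points (x , M ζ - x²) with x at most N and a level ζ.  As M exceeds every Vandermonde
-- determinant of three abscissae, an orientation is the one of the points (x , ζ), ties
-- being broken by the parabola.
module Levels (N M : ℕ) (N³<M : N * (N * N) < M) where

  placeℤ : ℕ → ℕ → ℤ × ℤ
  placeℤ x ζ = + x , + M ℤ.* + ζ ℤ.- + x ℤ.* + x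

  abstract
    place : ℕ → ℕ → Point
    place x ζ = fromℤ² (placeℤ x ζ)

    place-≡ : ∀ x ζ → place x ζ ≡ fromℤ² (placeℤ x ζ)
    place-≡ x ζ = refl

  vandermonde : ℕ → ℕ → ℕ → ℤ
  vandermonde p q r = (+ q ℤ.- + p) ℤ.* ((+ r ℤ.- + p) ℤ.* (+ r ℤ.- + q))

  levelOrient : ℕ → ℕ → ℕ → ℕ → ℕ → ℕ → ℤ
  levelOrient p pζ q qζ r rζ = orientℤ (+ p , + pζ) (+ q , + qζ) (+ r , + rζ)

  place-abscissa : ∀ {x ζ x′ ζ′} → place x ζ ≡ place x′ ζ′ → x ≡ x′
  place-abscissa {x} {ζ} {x′} {ζ′} eq = ℤ.+-injective
    (cong (λ P → ℚ.ℚ.numerator (proj₁ P)) (trans (sym (place-≡ x ζ)) (trans eq (place-≡ x′ ζ′))))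

  -- Orientation is linear in the ordinates: the levels contribute with factor `M`, and the points
  -- of the parabola `y = x * x` have the Vandermonde determinant as orientation.
  orient-place : ∀ p pζ q qζ r rζ → orient (place p pζ) (place q qζ) (place r rζ) ≡
                 fromℤ (+ M ℤ.* levelOrient p pζ q qζ r rζ ℤ.- vandermonde p q r)
  orient-place p pζ q qζ r rζ =
    trans (trans (cong₂ (λ P Q → orient P Q (place r rζ)) (place-≡ p pζ) (place-≡ q qζ))
      (cong (orient (fromℤ² (placeℤ p pζ)) (fromℤ² (placeℤ q qζ))) (place-≡ r rζ)))
    (trans (orient-fromℤ (placeℤ p pζ) (placeℤ q qζ) (placeℤ r rζ))
      (cong fromℤ (expand (+ M) (+ p) (+ pζ) (+ q) (+ qζ) (+ r) (+ rζ))))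
    where
    expand : ∀ M p pζ q qζ r rζ →
      (q ℤ.- p) ℤ.* ((M ℤ.* rζ ℤ.- r ℤ.* r) ℤ.- (M ℤ.* pζ ℤ.- p ℤ.* p)) ℤ.-
        ((M ℤ.* qζ ℤ.- q ℤ.* q) ℤ.- (M ℤ.* pζ ℤ.- p ℤ.* p)) ℤ.* (r ℤ.- p)
      ≡ M ℤ.* ((q ℤ.- p) ℤ.* (rζ ℤ.- pζ) ℤ.- (qζ ℤ.- pζ) ℤ.* (r ℤ.- p)) ℤ.- (q ℤ.- p) ℤ.* ((r ℤ.- p) ℤ.* (r ℤ.- q))
    expand = solve-∀

  vandermonde-bound : ∀ {p q r} → p ≤ N → q ≤ N → r ≤ N → ∣ vandermonde p q r ∣ < M
  vandermonde-bound {p} {q} {r} p≤N q≤N r≤N = ℕ.≤-<-trans (subst (_≤ N * (N * N))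
      (sym (trans (ℤ.abs-* (+ q ℤ.- + p) _) (cong (∣ + q ℤ.- + p ∣ *_) (ℤ.abs-* (+ r ℤ.- + p) (+ r ℤ.- + q)))))
      (ℕ.*-mono-≤ (∣m-n∣≤ q≤N p≤N) (ℕ.*-mono-≤ (∣m-n∣≤ r≤N p≤N) (∣m-n∣≤ r≤N q≤N)))) N³<M

  -- A positive integer is at least 1, and `M` alone outweighs the Vandermonde term. Writing the
  -- level orientation as a difference of naturals leaves only the inequality `b < a` to check.
  CCW-level : ∀ p pζ q qζ r rζ → p ≤ N → q ≤ N → r ≤ N → ∀ a b → b < a →
              levelOrient p pζ q qζ r rζ ≡ + a ℤ.- + b → CCW (place p pζ) (place q qζ) (place r rζ)
  CCW-level p pζ q qζ r rζ p≤N q≤N r≤N a b b<a D≡ = subst (0ℚ ℚ.<_) (sym (orient-place p pζ q qζ r rζ))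
    (fromℤ-mono-< (begin-strict
    0ℤ                                          ≡⟨ ℤ.+-inverseʳ V ⟨
    V ℤ.- V                                     <⟨ ℤ.+-monoˡ-< (ℤ.- V) (begin-strict
      V                   ≤⟨ i≤∣i∣ V ⟩
      + ∣ V ∣             <⟨ ℤ.+<+ (vandermonde-bound p≤N q≤N r≤N) ⟩
      + M                 ≡⟨ ℤ.*-identityʳ (+ M) ⟨
      + M ℤ.* 1ℤ          ≤⟨ ℤ.*-monoˡ-≤-nonNeg (+ M) 1≤D ⟩
      + M ℤ.* D ∎) ⟩
    + M ℤ.* D ℤ.- V ∎))
    where
    open ℤ.≤-Reasoning
    D = levelOrient p pζ q qζ r rζ
    V = vandermonde p q r
    1≤D : 1ℤ ℤ.≤ D
    1≤D = subst (1ℤ ℤ.≤_) (sym (trans D≡ (trans (ℤ.m-n≡m⊖n a b) (ℤ.⊖-≥ (ℕ.<⇒≤ b<a))))) (ℤ.+≤+ (ℕ.m<n⇒0<n∸m b<a))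

  -- On a common level only the concave parabola is left, whose middle point lies above the chord.
  CCW-flat : ∀ p q r ζ → p < r → r < q → CCW (place p ζ) (place q ζ) (place r ζ)
  CCW-flat p q r ζ p<r r<q = subst (0ℚ ℚ.<_) (sym (orient-place p ζ q ζ r ζ)) (fromℤ-mono-< (subst (0ℤ ℤ.<_)
      (trans (ℤ.pos-* (q ∸ p) _) (trans (cong₂ ℤ._*_ (∸-cast (ℕ.<⇒≤ (ℕ.<-trans p<r r<q)))
         (trans (ℤ.pos-* (r ∸ p) _) (cong₂ ℤ._*_ (∸-cast (ℕ.<⇒≤ p<r)) (∸-cast (ℕ.<⇒≤ r<q)))))
         (identity (+ M) (+ p) (+ q) (+ r) (+ ζ))))
      (ℤ.+<+ (ℕ.*-mono-≤ (ℕ.m<n⇒0<n∸m (ℕ.<-trans p<r r<q)) (ℕ.*-mono-≤ (ℕ.m<n⇒0<n∸m p<r) (ℕ.m<n⇒0<n∸m r<q))))))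
    where
    identity : ∀ M p q r ζ → (q ℤ.- p) ℤ.* ((r ℤ.- p) ℤ.* (q ℤ.- r)) ≡
      M ℤ.* ((q ℤ.- p) ℤ.* (ζ ℤ.- ζ) ℤ.- (ζ ℤ.- ζ) ℤ.* (r ℤ.- p)) ℤ.- (q ℤ.- p) ℤ.* ((r ℤ.- p) ℤ.* (r ℤ.- q))
    identity = solve-∀

  -- Orientation 0 would make the Vandermonde determinant a multiple of `M`. Being smaller than `M`
  -- it would be 0, although the abscissae are distinct.
  orient-place≢0 : ∀ p pζ q qζ r rζ → p ≤ N → q ≤ N → r ≤ N → p ≢ q → q ≢ r → p ≢ r →
                   orient (place p pζ) (place q qζ) (place r rζ) ≢ 0ℚ
  orient-place≢0 p pζ q qζ r rζ p≤N q≤N r≤N p≢q q≢r p≢r eq = V≢0 V≡0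
    where
    D = levelOrient p pζ q qζ r rζ
    V = vandermonde p q r
    MD≡V : + M ℤ.* D ≡ V
    MD≡V = ℤ.i-j≡0⇒i≡j _ _ (cong ℚ.ℚ.numerator (trans (sym (orient-place p pζ q qζ r rζ)) eq))
    M∣D∣≡∣V∣ : M * ∣ D ∣ ≡ ∣ V ∣
    M∣D∣≡∣V∣ = trans (sym (ℤ.abs-* (+ M) D)) (cong ∣_∣ MD≡V)
    small-multiple : ∀ d → M * d ≡ ∣ V ∣ → d ≡ 0
    small-multiple zero    _ = refl
    small-multiple (suc d) e = ⊥-elim (ℕ.<-irrefl (sym e)
      (ℕ.<-≤-trans (vandermonde-bound {p} {q} {r} p≤N q≤N r≤N) (ℕ.m≤m*n M (suc d))))
    V≡0 : V ≡ 0ℤ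
    V≡0 = trans (sym MD≡V) (trans (cong (+ M ℤ.*_) (ℤ.∣i∣≡0⇒i≡0 {D} (small-multiple ∣ D ∣ M∣D∣≡∣V∣))) (ℤ.*-zeroʳ (+ M)))
    difference≢0 : ∀ {m n} → m ≢ n → + m ℤ.- + n ≢ 0ℤ
    difference≢0 m≢n e = m≢n (ℤ.+-injective (ℤ.i-j≡0⇒i≡j _ _ e))
    V≢0 : V ≢ 0ℤ
    V≢0 V≡0 with ℤ.i*j≡0⇒i≡0∨j≡0 (+ q ℤ.- + p) V≡0
    ... | inj₁ e = difference≢0 (λ z → p≢q (sym z)) e
    ... | inj₂ e with ℤ.i*j≡0⇒i≡0∨j≡0 (+ r ℤ.- + p) e
    ...   | inj₁ e′ = difference≢0 (λ z → p≢r (sym z)) e′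
    ...   | inj₂ e′ = difference≢0 (λ z → q≢r (sym z)) e′

  -- In terms of levels, the line from `q` up to `p` has moved sideways by at most `h * N / H`, so
  -- by less than 1, when it reaches level `h`; an integer abscissa greater than `q` is still east
  -- of it.
  CCW-east : ∀ p H q r h → p ≤ N → q ≤ N → r ≤ N → h * N < H → q < r →
             CCW (place p H) (place q 0) (place r h)
  CCW-east p H q r h p≤N q≤N r≤N hN<H q<r = CCW-level p H q 0 r h p≤N q≤N r≤N (H * r + h * q) (H * q + h * p)
    (begin-strict
      H * q + h * p   ≤⟨ ℕ.+-monoʳ-≤ (H * q) (ℕ.*-monoʳ-≤ h p≤N) ⟩
      H * q + h * N   <⟨ ℕ.+-monoʳ-< (H * q) hN<H ⟩
      H * q + H       ≡⟨ trans (ℕ.+-comm (H * q) H) (sym (ℕ.*-suc H q)) ⟩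
      H * suc q       ≤⟨ ℕ.*-monoʳ-≤ H q<r ⟩
      H * r           ≤⟨ ℕ.m≤m+n _ _ ⟩
      H * r + h * q ∎)
    (trans (identity (+ p) (+ H) (+ q) (+ r) (+ h)) (sym (cong₂ ℤ._-_ (pos-*+* H r h q) (pos-*+* H q h p))))
    where
    open ℕ.≤-Reasoning
    identity : ∀ p H q r h → (q ℤ.- p) ℤ.* (h ℤ.- H) ℤ.- (+ 0 ℤ.- H) ℤ.* (r ℤ.- p) ≡ (H ℤ.* r ℤ.+ h ℤ.* q) ℤ.-
      (H ℤ.* q ℤ.+ h ℤ.* p)
    identity = solve-∀

  CCW-west : ∀ p H q r h → p ≤ N → q ≤ N → r ≤ N → h * N < H → r < q →
             CCW (place q 0) (place p H) (place r h)
  CCW-west p H q r h p≤N q≤N r≤N hN<H r<q = CCW-level q 0 p H r h q≤N p≤N r≤N (H * q + h * p) (H * r + h * q)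
    (begin-strict
      H * r + h * q   ≤⟨ ℕ.+-monoʳ-≤ (H * r) (ℕ.*-monoʳ-≤ h q≤N) ⟩
      H * r + h * N   <⟨ ℕ.+-monoʳ-< (H * r) hN<H ⟩
      H * r + H       ≡⟨ trans (ℕ.+-comm (H * r) H) (sym (ℕ.*-suc H r)) ⟩
      H * suc r       ≤⟨ ℕ.*-monoʳ-≤ H r<q ⟩
      H * q           ≤⟨ ℕ.m≤m+n _ _ ⟩
      H * q + h * p ∎)
    (trans (identity (+ p) (+ H) (+ q) (+ r) (+ h)) (sym (cong₂ ℤ._-_ (pos-*+* H q h p) (pos-*+* H r h q))))
    where
    open ℕ.≤-Reasoning
    identity : ∀ p H q r h → (p ℤ.- q) ℤ.* (h ℤ.- + 0) ℤ.- (H ℤ.- + 0) ℤ.* (r ℤ.- q) ≡ (H ℤ.* q ℤ.+ h ℤ.* p) ℤ.-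
      (H ℤ.* r ℤ.+ h ℤ.* q)
    identity = solve-∀

  CCW-below : ∀ p q r ζ η → p ≤ N → q ≤ N → r ≤ N → η < ζ → p < r → CCW (place p ζ) (place q η) (place r ζ)
  CCW-below p q r ζ η p≤N q≤N r≤N η<ζ p<r = CCW-level p ζ q η r ζ p≤N q≤N r≤N ((ζ ∸ η) * (r ∸ p)) 0
    (ℕ.*-mono-≤ (ℕ.m<n⇒0<n∸m η<ζ) (ℕ.m<n⇒0<n∸m p<r))
    (trans (identity (+ p) (+ q) (+ r) (+ ζ) (+ η))
      (cong (ℤ._- + 0) (sym (trans (ℤ.pos-* (ζ ∸ η) _) (cong₂ ℤ._*_ (∸-cast (ℕ.<⇒≤ η<ζ)) (∸-cast (ℕ.<⇒≤ p<r)))))))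
    where
    identity : ∀ p q r ζ η → (q ℤ.- p) ℤ.* (ζ ℤ.- ζ) ℤ.- (η ℤ.- ζ) ℤ.* (r ℤ.- p) ≡ (ζ ℤ.- η) ℤ.* (r ℤ.- p) ℤ.- + 0
    identity = solve-∀

  CCW-above : ∀ p q r ζ η → p ≤ N → q ≤ N → r ≤ N → ζ < η → r < p → CCW (place p ζ) (place q η) (place r ζ)
  CCW-above p q r ζ η p≤N q≤N r≤N ζ<η r<p = CCW-level p ζ q η r ζ p≤N q≤N r≤N ((η ∸ ζ) * (p ∸ r)) 0
    (ℕ.*-mono-≤ (ℕ.m<n⇒0<n∸m ζ<η) (ℕ.m<n⇒0<n∸m r<p))
    (trans (identity (+ p) (+ q) (+ r) (+ ζ) (+ η))
      (cong (ℤ._- + 0) (sym (trans (ℤ.pos-* (η ∸ ζ) _) (cong₂ ℤ._*_ (∸-cast (ℕ.<⇒≤ ζ<η)) (∸-cast (ℕ.<⇒≤ r<p)))))))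
    where
    identity : ∀ p q r ζ η → (q ℤ.- p) ℤ.* (ζ ℤ.- ζ) ℤ.- (η ℤ.- ζ) ℤ.* (r ℤ.- p) ≡ (η ℤ.- ζ) ℤ.* (p ℤ.- r) ℤ.- + 0
    identity = solve-∀

  -- The parabola lowers a point by less than `M`, the distance between consecutive levels.
  place-higher : ∀ x ζ x′ ζ′ → x′ ≤ N → ζ < ζ′ → proj₂ (place x ζ) ℚ.< proj₂ (place x′ ζ′)
  place-higher x ζ x′ ζ′ x′≤N ζ<ζ′ = subst₂ (λ P Q → proj₂ P ℚ.< proj₂ Q) (sym (place-≡ x ζ)) (sym (place-≡ x′ ζ′))
    (fromℤ-mono-< (begin-strict
    + M ℤ.* + ζ ℤ.- + x ℤ.* + x              ≡⟨ cong₂ ℤ._-_ (sym (ℤ.pos-* M ζ)) (sym (ℤ.pos-* x x)) ⟩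
    + (M * ζ) ℤ.- + (x * x)                  ≤⟨ ℤ.i-j≤i (+ (M * ζ)) (+ (x * x)) ⟩
    + (M * ζ)                                ≡⟨ add-sub (+ (M * ζ)) (+ M) ⟩
    + M ℤ.+ + (M * ζ) ℤ.- + M                ≡⟨ cong (ℤ._- + M)
      (trans (sym (ℤ.pos-+ M _)) (cong +_ (sym (ℕ.*-suc M ζ)))) ⟩
    + (M * suc ζ) ℤ.- + M                    <⟨ ℤ.+-monoʳ-< (+ (M * suc ζ)) (ℤ.neg-mono-< (ℤ.+<+ x′²<M)) ⟩
    + (M * suc ζ) ℤ.- + (x′ * x′)            ≤⟨ ℤ.+-monoˡ-≤ (ℤ.- + (x′ * x′)) (ℤ.+≤+ (ℕ.*-monoʳ-≤ M ζ<ζ′)) ⟩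
    + (M * ζ′) ℤ.- + (x′ * x′)               ≡⟨ cong₂ ℤ._-_ (ℤ.pos-* M ζ′) (ℤ.pos-* x′ x′) ⟩
    + M ℤ.* + ζ′ ℤ.- + x′ ℤ.* + x′ ∎))
    where
    open ℤ.≤-Reasoning
    add-sub : ∀ a b → a ≡ b ℤ.+ a ℤ.- b
    add-sub = solve-∀
    n²≤n³ : ∀ n → n * n ≤ n * (n * n)
    n²≤n³ zero    = z≤n
    n²≤n³ (suc n) = ℕ.m≤m+n _ _
    x′²<M : x′ * x′ < M
    x′²<M = ℕ.≤-<-trans (ℕ.*-mono-≤ x′≤N x′≤N) (ℕ.≤-<-trans (n²≤n³ N) N³<M)

  functional-place : ∀ a b x ζ → functional a b (place x ζ) ≡ fromℤ (a ℤ.* + x ℤ.+ b ℤ.* (+ M ℤ.* + ζ ℤ.- + x ℤ.* + x))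
  functional-place a b x ζ = trans (cong (functional a b) (place-≡ x ζ))
    (trans (cong₂ ℚ._+_ (fromℤ-* a (+ x)) (fromℤ-* b (+ M ℤ.* + ζ ℤ.- + x ℤ.* + x)))
      (fromℤ-+ (a ℤ.* + x) (b ℤ.* (+ M ℤ.* + ζ ℤ.- + x ℤ.* + x))))

  functional-< : ∀ a b x ζ x′ ζ′ →
    a ℤ.* + x ℤ.+ b ℤ.* (+ M ℤ.* + ζ ℤ.- + x ℤ.* + x) ℤ.< a ℤ.* + x′ ℤ.+ b ℤ.* (+ M ℤ.* + ζ′ ℤ.- + x′ ℤ.* + x′) →
    functional a b (place x ζ) ℚ.< functional a b (place x′ ζ′)
  functional-< a b x ζ x′ ζ′ lt = subst₂ ℚ._<_ (sym (functional-place a b x ζ)) (sym (functional-place a b x′ ζ′))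
    (fromℤ-mono-< lt)

  east-exposed : ∀ x ζ x′ ζ′ → x < x′ → functional 1ℤ 0ℤ (place x ζ) ℚ.< functional 1ℤ 0ℤ (place x′ ζ′)
  east-exposed x ζ x′ ζ′ x<x′ = functional-< 1ℤ 0ℤ x ζ x′ ζ′
    (subst₂ ℤ._<_ (abscissa (+ x) (+ M ℤ.* + ζ ℤ.- + x ℤ.* + x)) (abscissa (+ x′) (+ M ℤ.* + ζ′ ℤ.- + x′ ℤ.* + x′))
      (ℤ.+<+ x<x′))
    where
    abscissa : ∀ x y → x ≡ 1ℤ ℤ.* x ℤ.+ 0ℤ ℤ.* y
    abscissa = solve-∀

  west-exposed : ∀ x ζ x′ ζ′ → x′ < x → functional (ℤ.- 1ℤ) 0ℤ (place x ζ) ℚ.< functional (ℤ.- 1ℤ) 0ℤ (place x′ ζ′)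
  west-exposed x ζ x′ ζ′ x′<x = functional-< (ℤ.- 1ℤ) 0ℤ x ζ x′ ζ′
    (subst₂ ℤ._<_ (abscissa (+ x) (+ M ℤ.* + ζ ℤ.- + x ℤ.* + x)) (abscissa (+ x′) (+ M ℤ.* + ζ′ ℤ.- + x′ ℤ.* + x′))
      (ℤ.neg-mono-< (ℤ.+<+ x′<x)))
    where
    abscissa : ∀ x y → ℤ.- x ≡ ℤ.- 1ℤ ℤ.* x ℤ.+ 0ℤ ℤ.* y
    abscissa = solve-∀

  -- The functional is the one of the tangent of the parabola at x′.
  top-exposed : ∀ x ζ x′ ζ′ → ζ ≤ ζ′ → x ≢ x′ →
                functional (+ x′ ℤ.+ + x′) 1ℤ (place x ζ) ℚ.< functional (+ x′ ℤ.+ + x′) 1ℤ (place x′ ζ′)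
  top-exposed x ζ x′ ζ′ ζ≤ζ′ x≢x′ = functional-< (+ x′ ℤ.+ + x′) 1ℤ x ζ x′ ζ′
    (subst₂ ℤ._<_ (sym (lhs (+ x) (+ x′) (+ M) (+ ζ))) (sym (rhs (+ x) (+ x′) (+ M) (+ ζ′))) (begin-strict
      c ℤ.+ + M ℤ.* + ζ                        ≤⟨ ℤ.+-monoʳ-≤ c (ℤ.*-monoˡ-≤-nonNeg (+ M) (ℤ.+≤+ ζ≤ζ′)) ⟩
      c ℤ.+ + M ℤ.* + ζ′                       ≡⟨ ℤ.+-identityʳ _ ⟨
      c ℤ.+ + M ℤ.* + ζ′ ℤ.+ 0ℤ                <⟨ ℤ.+-monoʳ-< (c ℤ.+ + M ℤ.* + ζ′)
        (square-pos (λ e → x≢x′ (ℤ.+-injective (ℤ.i-j≡0⇒i≡j _ _ e)))) ⟩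
      c ℤ.+ + M ℤ.* + ζ′ ℤ.+ (+ x ℤ.- + x′) ℤ.* (+ x ℤ.- + x′) ∎))
    where
    open ℤ.≤-Reasoning
    c = (+ x′ ℤ.+ + x′) ℤ.* + x ℤ.- + x ℤ.* + x
    lhs : ∀ x x′ M ζ → (x′ ℤ.+ x′) ℤ.* x ℤ.+ 1ℤ ℤ.* (M ℤ.* ζ ℤ.- x ℤ.* x) ≡ ((x′ ℤ.+ x′) ℤ.* x ℤ.- x ℤ.* x) ℤ.+ M ℤ.* ζ
    lhs = solve-∀
    rhs : ∀ x x′ M ζ → (x′ ℤ.+ x′) ℤ.* x′ ℤ.+ 1ℤ ℤ.* (M ℤ.* ζ ℤ.- x′ ℤ.* x′) ≡
      ((x′ ℤ.+ x′) ℤ.* x ℤ.- x ℤ.* x) ℤ.+ M ℤ.* ζ ℤ.+ (x ℤ.- x′) ℤ.* (x ℤ.- x′)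
    rhs = solve-∀
    square-pos : ∀ {d} → d ≢ 0ℤ → 0ℤ ℤ.< d ℤ.* d
    square-pos {+ zero}  d≢0 = ⊥-elim (d≢0 refl)
    square-pos {+ suc _} _   = ℤ.+<+ (s≤s z≤n)
    square-pos { -[1+ _ ]} _ = ℤ.+<+ (s≤s z≤n)

-- Evaluation of the crossing rule for points off the horizontal line through `x`.

module _ {A : Set} {x y : A} where

  private
    if₃ : Bool → Bool → Bool → A
    if₃ a b c = if a ∧ b ∧ c then x else y

  if-all : ∀ {a b c} → a ≡ true → b ≡ true → c ≡ true → if₃ a b c ≡ x
  if-all refl refl refl = refl

  if-not₁ : ∀ {a d} → a ≡ false → (if a ∧ d then x else y) ≡ y
  if-not₁ refl = refl

  if-not₂ : ∀ a {b c} → b ≡ false → if₃ a b c ≡ y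
  if-not₂ false refl = refl
  if-not₂ true  refl = refl

  if-not₃ : ∀ a b {c} → c ≡ false → if₃ a b c ≡ y
  if-not₃ false _     refl = refl
  if-not₃ true  false refl = refl
  if-not₃ true  true  refl = refl

<⇒≱ : ∀ {p q} → p ℚ.< q → ¬ q ℚ.≤ p
<⇒≱ p<q q≤p = ℚ.<-irrefl refl (ℚ.<-≤-trans p<q q≤p)

CCW-swap : ∀ P Q R → CCW P Q R → orient Q P R ℚ.< 0ℚ
CCW-swap P Q R pqr = subst (ℚ._< 0ℚ) (sym (orient-swap Q P R)) (ℚ.neg-antimono-< pqr)

module _ (a b x : Point) where
  private
    a≤x? = proj₂ a ℚ.≤? proj₂ x
    x<b? = proj₂ x ℚ.<? proj₂ b
    b≤x? = proj₂ b ℚ.≤? proj₂ x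
    x<a? = proj₂ x ℚ.<? proj₂ a
    left? = 0ℚ ℚ.<? orient a b x
    right? = orient a b x ℚ.<? 0ℚ

  crossing-up-left : proj₂ a ℚ.< proj₂ x → proj₂ x ℚ.< proj₂ b → CCW a b x → crossing a b x ≡ 1ℤ
  crossing-up-left a<x x<b abx = if-all (dec-true a≤x? (ℚ.<⇒≤ a<x)) (dec-true x<b? x<b) (dec-true left? abx)

  crossing-up-right : proj₂ a ℚ.< proj₂ x → proj₂ x ℚ.< proj₂ b → CCW b a x → crossing a b x ≡ 0ℤ
  crossing-up-right a<x x<b bax = trans
    (if-not₃ (does a≤x?) (does x<b?) (dec-false left? (ℚ.<-asym (CCW-swap b a x bax))))
    (if-not₁ (dec-false b≤x? (<⇒≱ x<b)))

  crossing-down-right : proj₂ b ℚ.< proj₂ x → proj₂ x ℚ.< proj₂ a → CCW b a x → crossing a b x ≡ -1ℤ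
  crossing-down-right b<x x<a bax = trans
    (if-not₁ (dec-false a≤x? (<⇒≱ x<a)))
    (if-all (dec-true b≤x? (ℚ.<⇒≤ b<x)) (dec-true x<a? x<a) (dec-true right? (CCW-swap b a x bax)))

  crossing-down-left : proj₂ b ℚ.< proj₂ x → proj₂ x ℚ.< proj₂ a → CCW a b x → crossing a b x ≡ 0ℤ
  crossing-down-left b<x x<a abx = trans
    (if-not₁ (dec-false a≤x? (<⇒≱ x<a)))
    (if-not₃ (does b≤x?) (does x<a?) (dec-false right? (ℚ.<-asym abx)))

  crossing-above : proj₂ x ℚ.< proj₂ a → proj₂ x ℚ.< proj₂ b → crossing a b x ≡ 0ℤ
  crossing-above x<a x<b = trans (if-not₁ (dec-false a≤x? (<⇒≱ x<a))) (if-not₁ (dec-false b≤x? (<⇒≱ x<b)))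

  crossing-below : proj₂ a ℚ.< proj₂ x → proj₂ b ℚ.< proj₂ x → crossing a b x ≡ 0ℤ
  crossing-below a<x b<x = trans (if-not₂ (does a≤x?) (dec-false x<b? (ℚ.<-asym b<x)))
    (if-not₂ (does b≤x?) (dec-false x<a? (ℚ.<-asym a<x)))

-- Concatenated and interleaved sequences.

module _ {A : Set} where

  splitCases : ℕ → (ℕ → A) → (ℕ → A) → ℕ → A
  splitCases zero    f g v       = g v
  splitCases (suc b) f g zero    = f zero
  splitCases (suc b) f g (suc v) = splitCases b (f ∘ suc) g v

  splitCases-< : ∀ {b} f g {v} → v < b → splitCases b f g v ≡ f v
  splitCases-< {suc b} f g {zero}  _         = refl
  splitCases-< {suc b} f g {suc v} (s≤s v<b) = splitCases-< (f ∘ suc) g v<b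

  splitCases-+ : ∀ b f g w → splitCases b f g (b + w) ≡ g w
  splitCases-+ zero    f g w = refl
  splitCases-+ (suc b) f g w = splitCases-+ b (f ∘ suc) g w

  splitCases-elim : (P : ℕ → A → Set) → ∀ b f g → (∀ v → v < b → P v (f v)) → (∀ w → P (b + w) (g w)) →
                    ∀ v → P v (splitCases b f g v)
  splitCases-elim P zero    f g Pf Pg v       = Pg v
  splitCases-elim P (suc b) f g Pf Pg zero    = Pf zero (s≤s z≤n)
  splitCases-elim P (suc b) f g Pf Pg (suc v) = splitCases-elim (P ∘ suc) b (f ∘ suc) g
    (λ w w<b → Pf (suc w) (s≤s w<b)) Pg v

  alternate : (ℕ → A) → (ℕ → A) → ℕ → A
  alternate f g zero          = f zero
  alternate f g (suc zero)    = g zero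
  alternate f g (suc (suc v)) = alternate (f ∘ suc) (g ∘ suc) v

  alternate-even : ∀ f g t → alternate f g (t * 2) ≡ f t
  alternate-even f g zero    = refl
  alternate-even f g (suc t) = alternate-even (f ∘ suc) (g ∘ suc) t

  alternate-odd : ∀ f g t → alternate f g (suc (t * 2)) ≡ g t
  alternate-odd f g zero    = refl
  alternate-odd f g (suc t) = alternate-odd (f ∘ suc) (g ∘ suc) t

  alternate-elim : (P : ℕ → A → Set) → ∀ f g → (∀ t → P (t * 2) (f t)) → (∀ t → P (suc (t * 2)) (g t)) →
                   ∀ v → P v (alternate f g v)
  alternate-elim P f g Pf Pg zero          = Pf zero
  alternate-elim P f g Pf Pg (suc zero)    = Pg zero
  alternate-elim P f g Pf Pg (suc (suc v)) = alternate-elim (P ∘ suc ∘ suc) (f ∘ suc) (g ∘ suc) (Pf ∘ suc) (Pg ∘ suc) v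

-- The configuration: names, abscissae, levels and numbering of its points.

data Site : Set where
  west east       : Site
  top low mid red : ℕ → Site

-- The parameters are shifted: there are `3 + n` hull vertices and `suc l` red points, which turns
-- the bound on `k` into `k ≤ l * 2`.
module Configuration (n l k : ℕ) (k≤2l : k ≤ l * 2) where

  #tops #reds #blues : ℕ
  #tops  = suc n
  #reds  = suc l
  #blues = suc (suc (#tops + k))

  -- From west to east: `west`, the tops, red and low points alternating with a red one first, the
  -- mids, `east`. So `low t` lies between `red t` and `red (suc t)`, and the mids lie beyond all
  -- red points.
  abscissa : Site → ℕ
  abscissa west    = 0
  abscissa (top c) = suc c
  abscissa (red j) = suc (#tops + j * 2)
  abscissa (low t) = suc (#tops + suc (t * 2))
  abscissa (mid t) = suc (#tops + (#reds * 2 + t))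
  abscissa east    = suc (#tops + (#reds * 2 + k))

  width : ℕ
  width = abscissa east

  -- From one positive level to the next the factor exceeds the width, so the line through a lower point
  -- and a point on a higher level is so steep that abscissae decide on which side a point in between lies.
  level : Site → ℕ
  level west    = 0
  level east    = 0
  level (low t) = 0
  level (red j) = 1
  level (mid t) = suc width
  level (top c) = suc width * suc width

  -- The least `M` above the bound for the Vandermonde determinants.
  open Levels width (suc (width * (width * width))) ℕ.≤-refl public

  point : Site → Point
  point s = place (abscissa s) (level s)

  -- The numbers below `k` are shared out, even ones to `low` and odd ones to `mid`: `k` inner
  -- points, with no more mids than lows.
  data Blue : Site → Set where
    west : Blue west
    east : Blue east
    top  : ∀ {c} → c < #tops → Blue (top c)
    low  : ∀ {t} → t * 2 < k → Blue (low t)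
    mid  : ∀ {t} → suc (t * 2) < k → Blue (mid t)

  data Valid : Site → Set where
    blue : ∀ {s} → Blue s → Valid s
    red  : ∀ {j} → j < #reds → Valid (red j)

  private
    -- A left inverse of `abscissa` on valid sites; it yields injectivity without comparing every
    -- pair of kinds.
    decode : ℕ → Site
    decode zero    = west
    decode (suc v) = splitCases #tops top (splitCases (#reds * 2) (alternate red low) (splitCases k mid (λ _ → east))) v

    mid-index< : ∀ {t} → suc (t * 2) < k → t < k
    mid-index< {t} lt = ℕ.≤-<-trans (ℕ.≤-trans (ℕ.m≤m*n t 2) (ℕ.n≤1+n (t * 2))) lt

    low-index< : ∀ {t} → t * 2 < k → suc (t * 2) < #reds * 2
    low-index< lt = s≤s (s≤s (ℕ.≤-trans (ℕ.<⇒≤ lt) k≤2l))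

    decode-abscissa : ∀ {s} → Valid s → decode (abscissa s) ≡ s
    decode-abscissa (blue west)      = refl
    decode-abscissa (blue (top c<))  = splitCases-< top _ c<
    decode-abscissa (blue (low {t} t<)) = trans (splitCases-+ #tops top _ (suc (t * 2)))
      (trans (splitCases-< (alternate red low) _ (low-index< {t} t<)) (alternate-odd red low t))
    decode-abscissa (blue (mid {t} t<)) = trans (splitCases-+ #tops top _ (#reds * 2 + t))
      (trans (splitCases-+ (#reds * 2) (alternate red low) _ t) (splitCases-< mid _ (mid-index< t<)))
    decode-abscissa (blue east) = trans (splitCases-+ #tops top _ (#reds * 2 + k))
      (trans (splitCases-+ (#reds * 2) (alternate red low) _ k)
      (trans (cong (splitCases k mid (λ _ → east)) (sym (ℕ.+-identityʳ k))) (splitCases-+ k mid _ 0)))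
    decode-abscissa (red {j} j<) = trans (splitCases-+ #tops top _ (j * 2))
      (trans (splitCases-< (alternate red low) _ (ℕ.*-monoˡ-< 2 j<)) (alternate-even red low j))

  abscissa-injective : ∀ {s t} → Valid s → Valid t → abscissa s ≡ abscissa t → s ≡ t
  abscissa-injective vs vt eq = trans (sym (decode-abscissa vs)) (trans (cong decode eq) (decode-abscissa vt))

  abscissa<width : ∀ {s} → Valid s → s ≢ east → abscissa s < width
  abscissa<width (blue west) _ = s≤s z≤n
  abscissa<width (blue east) ≢east = contradiction refl ≢east
  abscissa<width (blue (top c<)) _ = s≤s (ℕ.≤-trans c< (ℕ.m≤m+n #tops _))
  abscissa<width (blue (low {t} t<)) _ = s≤s (ℕ.+-monoʳ-< #tops (ℕ.<-≤-trans (low-index< {t} t<) (ℕ.m≤m+n _ k)))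
  abscissa<width (blue (mid t<)) _ = s≤s (ℕ.+-monoʳ-< #tops (ℕ.+-monoʳ-< (#reds * 2) (mid-index< t<)))
  abscissa<width (red j<) _ = s≤s (ℕ.+-monoʳ-< #tops (ℕ.<-≤-trans (ℕ.*-monoˡ-< 2 j<) (ℕ.m≤m+n _ k)))

  0<abscissa : ∀ s → s ≢ west → 0 < abscissa s
  0<abscissa west    ≢west = contradiction refl ≢west
  0<abscissa east    _ = s≤s z≤n
  0<abscissa (top c) _ = s≤s z≤n
  0<abscissa (low t) _ = s≤s z≤n
  0<abscissa (mid t) _ = s≤s z≤n
  0<abscissa (red j) _ = s≤s z≤n

  abscissa≤width : ∀ {s} → Valid s → abscissa s ≤ width
  abscissa≤width {east} _ = ℕ.≤-refl
  abscissa≤width {west} v = ℕ.<⇒≤ (abscissa<width v λ ())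
  abscissa≤width {top c} v = ℕ.<⇒≤ (abscissa<width v λ ())
  abscissa≤width {low t} v = ℕ.<⇒≤ (abscissa<width v λ ())
  abscissa≤width {mid t} v = ℕ.<⇒≤ (abscissa<width v λ ())
  abscissa≤width {red j} v = ℕ.<⇒≤ (abscissa<width v λ ())

  -- The hull vertices come first, so that being one is the condition of having an index below
  -- `2 + #tops`.
  site : ℕ → Site
  site zero          = west
  site (suc zero)    = east
  site (suc (suc v)) = splitCases #tops top (alternate low mid) v

  index : Site → ℕ
  index west    = 0
  index east    = 1
  index (top c) = 2 + c
  index (low t) = 2 + (#tops + t * 2)
  index (mid t) = 2 + (#tops + suc (t * 2))
  index (red j) = #blues + j

  index-site : ∀ i → index (site i) ≡ i
  index-site zero          = refl
  index-site (suc zero)    = refl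
  index-site (suc (suc v)) = splitCases-elim (λ w s → index s ≡ 2 + w) #tops top (alternate low mid) (λ _ _ → refl)
    (alternate-elim (λ w s → index s ≡ 2 + (#tops + w)) low mid (λ _ → refl) (λ _ → refl)) v

  blue-site : ∀ i → i < #blues → Blue (site i)
  blue-site zero          _                = west
  blue-site (suc zero)    _                = east
  blue-site (suc (suc v)) (s≤s (s≤s v<)) = splitCases-elim (λ w s → w < #tops + k → Blue s) #tops top
    (alternate low mid) (λ _ c< _ → top c<)
    (alternate-elim (λ w s → #tops + w < #tops + k → Blue s) low mid
       (λ _ lt → low (ℕ.+-cancelˡ-< #tops _ _ lt)) (λ _ lt → mid (ℕ.+-cancelˡ-< #tops _ _ lt))) v v<

  site-index : ∀ {s} → Blue s → site (index s) ≡ s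
  site-index west      = refl
  site-index east      = refl
  site-index (top c<)  = splitCases-< top _ c<
  site-index (low {t} _) = trans (splitCases-+ #tops top _ (t * 2)) (alternate-even low mid t)
  site-index (mid {t} _) = trans (splitCases-+ #tops top _ (suc (t * 2))) (alternate-odd low mid t)

  index<#blues : ∀ {s} → Blue s → index s < #blues
  index<#blues west     = s≤s z≤n
  index<#blues east     = s≤s (s≤s z≤n)
  index<#blues (top c<) = s≤s (s≤s (ℕ.<-≤-trans c< (ℕ.m≤m+n #tops k)))
  index<#blues (low t<) = s≤s (s≤s (ℕ.+-monoʳ-< #tops t<))
  index<#blues (mid t<) = s≤s (s≤s (ℕ.+-monoʳ-< #tops t<))

  data Inner : Site → Set where
    low : ∀ {t} → Inner (low t)
    mid : ∀ {t} → Inner (mid t)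
    red : ∀ {j} → Inner (red j)

  data Outer : Site → Set where
    west : Outer west
    east : Outer east
    top  : ∀ {c} → Outer (top c)

  outer-or-inner : ∀ i → (i < 2 + #tops × Outer (site i)) ⊎ (2 + #tops ≤ i × Inner (site i))
  outer-or-inner zero          = inj₁ (s≤s z≤n , west)
  outer-or-inner (suc zero)    = inj₁ (s≤s (s≤s z≤n) , east)
  outer-or-inner (suc (suc v)) = splitCases-elim (λ w s → (2 + w < 2 + #tops × Outer s) ⊎
    (2 + #tops ≤ 2 + w × Inner s)) #tops top (alternate low mid)
    (λ _ c< → inj₁ (s≤s (s≤s c<) , top))
    (alternate-elim (λ w s → (2 + (#tops + w) < 2 + #tops × Outer s) ⊎ (2 + #tops ≤ 2 + (#tops + w) × Inner s)) low mid
      (λ _ → inj₂ (s≤s (s≤s (ℕ.m≤m+n #tops _)) , low)) (λ _ → inj₂ (s≤s (s≤s (ℕ.m≤m+n #tops _)) , mid))) v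

  1≤width : 1 ≤ width
  1≤width = s≤s z≤n

  inner-level : ∀ {s} → Inner s → level s * width < suc width * suc width
  inner-level low = s≤s z≤n
  inner-level mid = ℕ.*-monoʳ-< (suc width) (ℕ.n<1+n width)
  inner-level red = ℕ.≤-<-trans (ℕ.≤-reflexive (ℕ.*-identityˡ width))
    (ℕ.<-≤-trans ℕ.≤-refl (ℕ.m≤m*n (suc width) (suc width)))

  level≤top : ∀ s → level s ≤ suc width * suc width
  level≤top west    = z≤n
  level≤top east    = z≤n
  level≤top (low t) = z≤n
  level≤top (red j) = s≤s z≤n
  level≤top (mid t) = ℕ.m≤m*n (suc width) (suc width)
  level≤top (top c) = ℕ.≤-refl

  -- General position and hull vertices of the configuration.

  B : Fin #blues → Point
  B i = point (site (toℕ i))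

  R : Fin #reds → Point
  R j = point (red (toℕ j))

  siteOf : Fin (#blues + #reds) → Site
  siteOf i = [ site ∘ toℕ , red ∘ toℕ ]′ (splitAt #blues i)

  B++R-site : ∀ i → (B ++ R) i ≡ point (siteOf i)
  B++R-site i with splitAt #blues i
  ... | inj₁ _ = refl
  ... | inj₂ _ = refl

  valid-siteOf : ∀ i → Valid (siteOf i)
  valid-siteOf i with splitAt #blues i
  ... | inj₁ b = blue (blue-site (toℕ b) (Fin.toℕ<n b))
  ... | inj₂ r = red (Fin.toℕ<n r)

  index-siteOf : ∀ i → index (siteOf i) ≡ toℕ i
  index-siteOf i with splitAt #blues i in eq
  ... | inj₁ b = trans (index-site (toℕ b)) (trans (sym (Fin.toℕ-↑ˡ b #reds)) (cong toℕ (Fin.splitAt⁻¹-↑ˡ eq)))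
  ... | inj₂ r = trans (sym (Fin.toℕ-↑ʳ #blues r)) (cong toℕ (Fin.splitAt⁻¹-↑ʳ eq))

  siteOf-injective : ∀ {i j} → siteOf i ≡ siteOf j → i ≡ j
  siteOf-injective {i} {j} eq = Fin.toℕ-injective (trans (sym (index-siteOf i))
    (trans (cong index eq) (index-siteOf j)))

  abscissa-siteOf≢ : ∀ {i j} → i ≢ j → abscissa (siteOf i) ≢ abscissa (siteOf j)
  abscissa-siteOf≢ {i} {j} i≢j eq = i≢j (siteOf-injective (abscissa-injective (valid-siteOf i) (valid-siteOf j) eq))

  B++R-injective : Injective _≡_ _≡_ (B ++ R)
  B++R-injective {i} {j} eq = siteOf-injective (abscissa-injective (valid-siteOf i) (valid-siteOf j)
    (place-abscissa (trans (sym (B++R-site i)) (trans eq (B++R-site j)))))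

  generalPosition : GeneralPosition (B ++ R)
  generalPosition i j h i≢j j≢h i≢h
    rewrite B++R-site i | B++R-site j | B++R-site h =
    orient-place≢0 _ (level (siteOf i)) _ (level (siteOf j)) _ (level (siteOf h))
      (abscissa≤width (valid-siteOf i)) (abscissa≤width (valid-siteOf j)) (abscissa≤width (valid-siteOf h))
      (abscissa-siteOf≢ i≢j) (abscissa-siteOf≢ j≢h) (abscissa-siteOf≢ i≢h)

  exposed : ∀ i a b → (∀ {s} → Valid s → abscissa s ≢ abscissa (siteOf i) →
              functional a b (point s) ℚ.< functional a b (point (siteOf i))) →
            IsHullVertex (B ++ R) ((B ++ R) i)
  exposed i a b below = exposed⇒hullVertex (B ++ R) i (fromℤ a) (fromℤ b) compare
    where
    compare : ∀ j → (B ++ R) j ≡ (B ++ R) i ⊎ functional a b ((B ++ R) j) ℚ.< functional a b ((B ++ R) i)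
    compare j with abscissa (siteOf j) ℕ.≟ abscissa (siteOf i)
    ... | yes eq = inj₁ (trans (B++R-site j) (trans
      (cong point (abscissa-injective (valid-siteOf j) (valid-siteOf i) eq)) (sym (B++R-site i))))
    ... | no neq = inj₂ (subst₂ (λ P Q → functional a b P ℚ.< functional a b Q) (sym (B++R-site j))
      (sym (B++R-site i)) (below (valid-siteOf j) neq))

  -- `west` and `east` have extreme abscissae. The tops share the highest level, where the tangent
  -- of the parabola at a top singles it out.
  outer-exposed : ∀ {o} → Outer o → ∃ λ a → ∃ λ b → ∀ {s} → Valid s → abscissa s ≢ abscissa o →
                  functional a b (point s) ℚ.< functional a b (point o)
  outer-exposed west = ℤ.- 1ℤ , 0ℤ , λ {s} _ neq →
    west-exposed (abscissa s) (level s) 0 0 (0<abscissa s (neq ∘ cong abscissa))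
  outer-exposed east = 1ℤ , 0ℤ , λ {s} v neq →
    east-exposed (abscissa s) (level s) width 0 (abscissa<width v (neq ∘ cong abscissa))
  outer-exposed (top {c}) = + suc c ℤ.+ + suc c , 1ℤ , λ {s} _ neq →
    top-exposed (abscissa s) (level s) (suc c) (suc width * suc width) (level≤top s) neq

  outer⇒hullVertex : ∀ i → Outer (siteOf i) → IsHullVertex (B ++ R) ((B ++ R) i)
  outer⇒hullVertex i o = let (a , b , below) = outer-exposed o in exposed i a b below

  inner-left-of-base : ∀ {s} → Valid s → Inner s → CCW (point west) (point east) (point s)
  inner-left-of-base {s} v low = CCW-flat 0 width (abscissa s) 0 (s≤s z≤n) (abscissa<width v λ ())
  inner-left-of-base {s} v mid = CCW-rotate (point s) (point west) (point east)
    (CCW-rotate (point east) (point s) (point west)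
    (CCW-above width (abscissa s) 0 0 (suc width) ℕ.≤-refl (abscissa≤width v) z≤n (s≤s z≤n) (s≤s z≤n)))
  inner-left-of-base {s} v red = CCW-rotate (point s) (point west) (point east)
    (CCW-rotate (point east) (point s) (point west)
    (CCW-above width (abscissa s) 0 0 1 ℕ.≤-refl (abscissa≤width v) z≤n (s≤s z≤n) (s≤s z≤n)))

  inner≢west : ∀ {s} → Inner s → s ≢ west
  inner≢west () refl
  inner≢east : ∀ {s} → Inner s → s ≢ east
  inner≢east () refl

  -- The triangle of `west`, `east` and `top 0`, which have indices 0, 1 and 2, contains all inner
  -- points: its sides at `top 0` are so steep that every abscissa strictly between the ends of the
  -- base lies between them.
  inner⇒¬hullVertex : ∀ {s} → Valid s → Inner s → ¬ IsHullVertex (B ++ R) (point s)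
  inner⇒¬hullVertex {s} v i = inTriangle⇒¬hullVertex (B ++ R) Fin.zero (Fin.suc Fin.zero)
    (Fin.suc (Fin.suc Fin.zero)) (point s)
    (inner-left-of-base v i)
    (CCW-west 1 (suc width * suc width) width (abscissa s) (level s) 1≤width ℕ.≤-refl (abscissa≤width v)
      (inner-level i) (abscissa<width v (inner≢east i)))
    (CCW-east 1 (suc width * suc width) 0 (abscissa s) (level s) 1≤width z≤n (abscissa≤width v) (inner-level i)
      (0<abscissa s (inner≢west i)))

  siteOf-↑ˡ : ∀ i → siteOf (i ↑ˡ #reds) ≡ site (toℕ i)
  siteOf-↑ˡ i = cong [ site ∘ toℕ , red ∘ toℕ ]′ (Fin.splitAt-↑ˡ #blues i #reds)

  hullVertices : ∀ i → IsHullVertex (B ++ R) (B i) ⇔ toℕ i < 2 + #tops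
  hullVertices i = [ (λ (i< , outer) → mk⇔ (λ _ → i<) λ _ → subst (IsHullVertex (B ++ R)) (lookup-++ˡ B R i)
                        (outer⇒hullVertex (i ↑ˡ #reds) (subst Outer (sym (siteOf-↑ˡ i)) outer)))
                   , (λ (≤i , inner) → mk⇔ (λ h → contradiction h
                     (inner⇒¬hullVertex (blue (blue-site (toℕ i) (Fin.toℕ<n i))) inner))
                        λ i< → contradiction i< (ℕ.≤⇒≯ ≤i)) ]′ (outer-or-inner (toℕ i))

  redsInside : ∀ j → ¬ IsHullVertex (B ++ R) (R j)
  redsInside j = inner⇒¬hullVertex (red (Fin.toℕ<n j)) red

  -- Lower and upper points; winding numbers around red points.

  data Lower : Site → Set where
    west : Lower west
    east : Lower east
    low  : ∀ {t} → Lower (low t)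

  data Upper : Site → Set where
    top : ∀ {c} → Upper (top c)
    mid : ∀ {t} → Upper (mid t)

  lower-or-upper : ∀ {s} → Blue s → Lower s ⊎ Upper s
  lower-or-upper west    = inj₁ west
  lower-or-upper east    = inj₁ east
  lower-or-upper (low _) = inj₁ low
  lower-or-upper (top _) = inj₂ top
  lower-or-upper (mid _) = inj₂ mid

  lower-level : ∀ {s} → Lower s → level s ≡ 0
  lower-level west = refl
  lower-level east = refl
  lower-level low  = refl

  width<level : ∀ {s} → Upper s → width < level s
  width<level mid = ℕ.n<1+n width
  width<level top = ℕ.<-≤-trans (ℕ.n<1+n width) (ℕ.m≤m*n (suc width) (suc width))

  0<level : ∀ {s} → Upper s → 0 < level s
  0<level u = ℕ.≤-<-trans z≤n (width<level u)

  lower-point : ∀ {s} → Lower s → point s ≡ place (abscissa s) 0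
  lower-point {s} L = cong (place (abscissa s)) (lower-level L)

  east-of : ∀ {p q r} → Valid p → Valid q → Valid r → Lower q → level r * width < level p → abscissa q < abscissa r →
            CCW (point p) (point q) (point r)
  east-of {p} {q} {r} vp vq vr L lt q<r = subst (λ Q → CCW (point p) Q (point r)) (sym (lower-point L))
    (CCW-east (abscissa p) (level p) (abscissa q) (abscissa r) (level r) (abscissa≤width vp) (abscissa≤width vq)
      (abscissa≤width vr) lt q<r)

  west-of : ∀ {p q r} → Valid p → Valid q → Valid r → Lower q → level r * width < level p → abscissa r < abscissa q →
            CCW (point q) (point p) (point r)
  west-of {p} {q} {r} vp vq vr L lt r<q = subst (λ Q → CCW Q (point p) (point r)) (sym (lower-point L))
    (CCW-west (abscissa p) (level p) (abscissa q) (abscissa r) (level r) (abscissa≤width vp) (abscissa≤width vq)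
      (abscissa≤width vr) lt r<q)

  lower-lower-level : ∀ {r p} → Lower r → Upper p → level r * width < level p
  lower-lower-level L U = subst (λ z → z * width < _) (sym (lower-level L)) (0<level U)

  red-level : ∀ {p} → Upper p → 1 * width < level p
  red-level {p} U = subst (_< level p) (sym (ℕ.*-identityˡ width)) (width<level U)

  isUpper : Site → ℤ
  isUpper (top _) = 1ℤ
  isUpper (mid _) = 1ℤ
  isUpper _       = 0ℤ

  isEast : ℕ → Site → ℤ
  isEast θ s = if does (θ ℕ.<? abscissa s) then 1ℤ else 0ℤ

  isLowerEast : ℕ → Site → ℤ
  isLowerEast θ west    = isEast θ west
  isLowerEast θ east    = isEast θ east
  isLowerEast θ (low t) = isEast θ (low t)
  isLowerEast θ _       = 0ℤ

  isUpper-upper : ∀ {s} → Upper s → isUpper s ≡ 1ℤ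
  isUpper-upper top = refl
  isUpper-upper mid = refl

  isUpper-lower : ∀ {s} → Lower s → isUpper s ≡ 0ℤ
  isUpper-lower west = refl
  isUpper-lower east = refl
  isUpper-lower low  = refl

  isLowerEast-upper : ∀ {θ s} → Upper s → isLowerEast θ s ≡ 0ℤ
  isLowerEast-upper top = refl
  isLowerEast-upper mid = refl

  isLowerEast-lower : ∀ {θ s} → Lower s → isLowerEast θ s ≡ isEast θ s
  isLowerEast-lower west = refl
  isLowerEast-lower east = refl
  isLowerEast-lower low  = refl

  lower-east : ∀ {θ s} → Lower s → θ < abscissa s → isLowerEast θ s ≡ 1ℤ
  lower-east {θ} {s} L lt = trans (isLowerEast-lower L) (cong (if_then 1ℤ else 0ℤ) (dec-true (θ ℕ.<? abscissa s) lt))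

  lower-west : ∀ {θ s} → Lower s → ¬ θ < abscissa s → isLowerEast θ s ≡ 0ℤ
  lower-west {θ} {s} L nlt = trans (isLowerEast-lower L) (cong (if_then 1ℤ else 0ℤ) (dec-false (θ ℕ.<? abscissa s) nlt))

  lower≢red : ∀ {s j} → Blue s → j < #reds → abscissa s ≢ abscissa (red j)
  lower≢red b j< eq with refl ← abscissa-injective (blue b) (red j<) eq with () ← b

  module _ {j} (j< : j < #reds) where
    private
      r = point (red j)
      θ = abscissa (red j)

      below-red : ∀ {s} → Lower s → proj₂ (point s) ℚ.< proj₂ r
      below-red {s} L = place-higher (abscissa s) (level s) θ 1 (abscissa≤width (red j<))
        (subst (_< 1) (sym (lower-level L)) (s≤s z≤n))

      above-red : ∀ {s} → Valid s → Upper s → proj₂ r ℚ.< proj₂ (point s)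
      above-red {s} v U = place-higher θ 1 (abscissa s) (level s) (abscissa≤width v)
        (ℕ.≤-<-trans 1≤width (width<level U))

    crossing-lower-upper : ∀ {s t} → Blue s → Blue t → Lower s → Upper t → crossing (point s) (point t) r
      ≡ isLowerEast θ s
    crossing-lower-upper {s} {t} bs bt L U = compare (ℕ.<-cmp (abscissa s) θ)
      where
      compare : Tri (abscissa s < θ) (abscissa s ≡ θ) (θ < abscissa s) → crossing (point s) (point t) r
        ≡ isLowerEast θ s
      compare (tri< s<θ _ s≯θ) = trans (crossing-up-right (point s) (point t) r (below-red L) (above-red (blue bt) U)
        (east-of (blue bt) (blue bs) (red j<) L (red-level U) s<θ)) (sym (lower-west L s≯θ))
      compare (tri≈ _ eq _)    = contradiction eq (lower≢red bs j<)
      compare (tri> _ _ θ<s)   = trans (crossing-up-left (point s) (point t) r (below-red L) (above-red (blue bt) U)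
        (west-of (blue bt) (blue bs) (red j<) L (red-level U) θ<s)) (sym (lower-east L θ<s))

    crossing-upper-lower : ∀ {s t} → Blue s → Blue t → Upper s → Lower t → crossing (point s) (point t) r
      ≡ ℤ.- isLowerEast θ t
    crossing-upper-lower {s} {t} bs bt U L = compare (ℕ.<-cmp (abscissa t) θ)
      where
      compare : Tri (abscissa t < θ) (abscissa t ≡ θ) (θ < abscissa t) → crossing (point s) (point t) r
        ≡ ℤ.- isLowerEast θ t
      compare (tri< t<θ _ t≯θ) = trans (crossing-down-left (point s) (point t) r (below-red L) (above-red (blue bs) U)
        (east-of (blue bs) (blue bt) (red j<) L (red-level U) t<θ)) (cong ℤ.-_ (sym (lower-west L t≯θ)))
      compare (tri≈ _ eq _)    = contradiction eq (lower≢red bt j<)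
      compare (tri> _ _ θ<t)   = trans (crossing-down-right (point s) (point t) r (below-red L) (above-red (blue bs) U)
        (west-of (blue bs) (blue bt) (red j<) L (red-level U) θ<t)) (cong ℤ.-_ (sym (lower-east L θ<t)))

    -- Only an edge between a lower and an upper point meets the height of the red point, and by
    -- steepness it passes east of it exactly when its lower end lies east. The right side is the
    -- summand of `flow`.
    crossing-red : ∀ {s t} → Blue s → Blue t →
                   crossing (point s) (point t) r ≡ isLowerEast θ s ℤ.* isUpper t ℤ.- isLowerEast θ t ℤ.* isUpper s
    crossing-red {s} {t} bs bt = cases (lower-or-upper bs) (lower-or-upper bt)
      where
      flux : ∀ {a b c d} → isLowerEast θ s ≡ a → isUpper t ≡ b → isLowerEast θ t ≡ c → isUpper s ≡ d →
             a ℤ.* b ℤ.- c ℤ.* d ≡ isLowerEast θ s ℤ.* isUpper t ℤ.- isLowerEast θ t ℤ.* isUpper s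
      flux refl refl refl refl = refl
      none : ∀ a b → 0ℤ ≡ a ℤ.* 0ℤ ℤ.- b ℤ.* 0ℤ
      none = solve-∀
      up : ∀ a → a ≡ a ℤ.* 1ℤ ℤ.- 0ℤ ℤ.* 0ℤ
      up = solve-∀
      down : ∀ a → ℤ.- a ≡ 0ℤ ℤ.* 0ℤ ℤ.- a ℤ.* 1ℤ
      down = solve-∀
      cases : Lower s ⊎ Upper s → Lower t ⊎ Upper t →
              crossing (point s) (point t) r ≡ isLowerEast θ s ℤ.* isUpper t ℤ.- isLowerEast θ t ℤ.* isUpper s
      cases (inj₁ Ls) (inj₁ Lt) = trans (crossing-below (point s) (point t) r (below-red Ls) (below-red Lt))
        (trans (none (isLowerEast θ s) (isLowerEast θ t)) (flux refl (isUpper-lower Lt) refl (isUpper-lower Ls)))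
      cases (inj₂ Us) (inj₂ Ut) = trans (crossing-above (point s) (point t) r (above-red (blue bs) Us)
        (above-red (blue bt) Ut))
        (flux (isLowerEast-upper Us) (isUpper-upper Ut) (isLowerEast-upper Ut) (isUpper-upper Us))
      cases (inj₁ Ls) (inj₂ Ut) = trans (crossing-lower-upper bs bt Ls Ut)
        (trans (up (isLowerEast θ s)) (flux refl (isUpper-upper Ut) (isLowerEast-upper Ut) (isUpper-lower Ls)))
      cases (inj₂ Us) (inj₁ Lt) = trans (crossing-upper-lower bs bt Us Lt)
        (trans (down (isLowerEast θ t)) (flux (isLowerEast-upper Us) (isUpper-lower Lt) refl (isUpper-upper Us)))

  -- Pairs of edges that are forced to cross.

  data _≺_ : Site → Site → Set where
    top≺mid : ∀ {c t} → top c ≺ mid t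
    mid≺mid : ∀ {s t} → s < t → mid s ≺ mid t

  ≺-upperˡ : ∀ {u w} → u ≺ w → Upper u
  ≺-upperˡ top≺mid     = top
  ≺-upperˡ (mid≺mid _) = mid

  ≺-upperʳ : ∀ {u w} → u ≺ w → Upper w
  ≺-upperʳ top≺mid     = mid
  ≺-upperʳ (mid≺mid _) = mid

  -- For a top `u` the line to `q` is steep and `w` is east of `q`; two mids share a level, with `q`
  -- below them and `w` further east.
  left-of-upper : ∀ {u w q} → u ≺ w → Blue u → Blue w → Blue q → Lower q → abscissa q < abscissa w →
                  CCW (point u) (point q) (point w)
  left-of-upper (top≺mid {t = t}) bu bw bq L q<w = east-of (blue bu) (blue bq) (blue bw) L (inner-level (mid {t})) q<w
  left-of-upper {mid s} {mid t} {q} (mid≺mid s<t) bu bw bq L _ =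
    CCW-below (abscissa (mid s)) (abscissa q) (abscissa (mid t)) (suc width) (level q)
      (abscissa≤width (blue bu)) (abscissa≤width (blue bq)) (abscissa≤width (blue bw))
      (subst (_< suc width) (sym (lower-level L)) (s≤s z≤n)) (s≤s (ℕ.+-monoʳ-< #tops (ℕ.+-monoʳ-< (#reds * 2) s<t)))

  -- The ends are in opposite orders above and below: `u` precedes `w` but is joined to the more
  -- eastern lower point. Steepness separates the lower ends, `left-of-upper` the upper ones.
  stair-crossing : ∀ {u w a b} → u ≺ w → Blue u → Blue w → Blue a → Blue b → Lower a → Lower b →
                   abscissa a < abscissa b → abscissa b < abscissa w →
                   ∃ λ X → OnSeg (point u) (point b) X × OnSeg (point w) (point a) X
  stair-crossing {u} {w} {a} {b} u≺w bu bw ba bb La Lb a<b b<w = segments-cross (point u) (point b) (point w) (point a)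
    (left-of-upper u≺w bu bw bb Lb b<w)
    (west-of (blue bu) (blue bb) (blue ba) Lb (lower-lower-level La (≺-upperˡ u≺w)) a<b)
    (east-of (blue bw) (blue ba) (blue bb) La (lower-lower-level Lb (≺-upperʳ u≺w)) a<b)
    (CCW-rotate (point u) (point a) (point w) (left-of-upper u≺w bu bw ba La (ℕ.<-trans a<b b<w)))

  -- The sites strictly on the eastern side of the chord from `west` to `top c`.
  data Beyond (c : ℕ) : Site → Set where
    east : Beyond c east
    low  : ∀ {t} → Beyond c (low t)
    mid  : ∀ {t} → Beyond c (mid t)
    top  : ∀ {d} → c < d → Beyond c (top d)

  weaken-Beyond : ∀ {c d s} → c ≤ d → Beyond d s → Beyond c s
  weaken-Beyond c≤d east      = east
  weaken-Beyond c≤d low       = low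
  weaken-Beyond c≤d mid       = mid
  weaken-Beyond c≤d (top d<e) = top (ℕ.≤-<-trans c≤d d<e)

  beyond-west : ∀ {c y} → Blue (top c) → Blue y → Beyond c y → CCW (point (top c)) (point west) (point y)
  beyond-west bc by east = east-of (blue bc) (blue west) (blue by) west (s≤s z≤n) (s≤s z≤n)
  beyond-west bc by low  = east-of (blue bc) (blue west) (blue by) west (s≤s z≤n) (s≤s z≤n)
  beyond-west bc by (mid {t}) = east-of (blue bc) (blue west) (blue by) west (inner-level (mid {t})) (s≤s z≤n)
  beyond-west {c} bc by (top {d} c<d) = CCW-below (suc c) 0 (suc d) (suc width * suc width) 0
    (abscissa≤width (blue bc)) z≤n (abscissa≤width (blue by)) (s≤s z≤n) (s≤s c<d)

  -- A later top is on the same level, where `top c` rises above the chord from `top j`; any other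
  -- `y` is on a lower level than the two tops.
  beyond-tops : ∀ {j c y} → j < c → Blue (top j) → Blue (top c) → Blue y → Beyond c y →
                CCW (point (top j)) (point y) (point (top c))
  beyond-tops {j} {c} j<c bj bc by (top {d} c<d) = CCW-flat (suc j) (suc d) (suc c) (suc width * suc width)
    (s≤s j<c) (s≤s c<d)
  beyond-tops {j} {c} {y} j<c bj bc by east = CCW-below (suc j) (abscissa y) (suc c) (suc width * suc width) 0
    (abscissa≤width (blue bj)) (abscissa≤width (blue by)) (abscissa≤width (blue bc)) (s≤s z≤n) (s≤s j<c)
  beyond-tops {j} {c} {y} j<c bj bc by low = CCW-below (suc j) (abscissa y) (suc c) (suc width * suc width) 0
    (abscissa≤width (blue bj)) (abscissa≤width (blue by)) (abscissa≤width (blue bc)) (s≤s z≤n) (s≤s j<c)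
  beyond-tops {j} {c} {y} j<c bj bc by mid = CCW-below (suc j) (abscissa y) (suc c) (suc width * suc width) (suc width)
    (abscissa≤width (blue bj)) (abscissa≤width (blue by)) (abscissa≤width (blue bc))
    (ℕ.m<m*n (suc width) (suc width) (s≤s (s≤s z≤n))) (s≤s j<c)

  chord-crossing : ∀ {j c y} → j < c → Blue (top j) → Blue (top c) → Blue y → Beyond c y →
                   ∃ λ X → OnSeg (point west) (point (top c)) X × OnSeg (point (top j)) (point y) X
  chord-crossing {j} {c} {y} j<c bj bc by beyond = segments-cross (point west) (point (top c)) (point (top j)) (point y)
    (CCW-rotate (point (top j)) (point west) (point (top c)) (beyond-west bj bc (top j<c)))
    (beyond-west bc by beyond)
    (beyond-tops j<c bj bc by beyond)
    (CCW-rotate (point west) (point y) (point (top j)) (CCW-rotate (point (top j)) (point west) (point y)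
      (beyond-west bj by (weaken-Beyond (ℕ.<⇒≤ j<c) beyond))))

  -- `west` heads the sequence of lower vertices, so `low j` is the step following `stair j`.
  stair : ℕ → Site
  stair zero    = west
  stair (suc j) = low j

  stair-lower : ∀ j → Lower (stair j)
  stair-lower zero    = west
  stair-lower (suc j) = low

  stair-ascends : ∀ j → abscissa (stair j) < abscissa (low j)
  stair-ascends zero    = s≤s z≤n
  stair-ascends (suc j) = s≤s (ℕ.+-monoʳ-< #tops (s≤s (ℕ.*-monoˡ-< 2 (ℕ.n<1+n j))))

  low<mid : ∀ {t s} → Blue (low t) → abscissa (low t) < abscissa (mid s)
  low<mid (low t<) = s≤s (ℕ.+-monoʳ-< #tops (ℕ.<-≤-trans (s≤s (s≤s (ℕ.≤-trans (ℕ.<⇒≤ t<) k≤2l)))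
    (ℕ.m≤m+n (#reds * 2) _)))

  -- The bound on `k` at work: each low point still has a red point to its east, which closes its
  -- gap.
  low⇒red : ∀ {t} → Blue (low t) → suc t < #reds
  low⇒red {t} (low t<) = s≤s (ℕ.*-cancelʳ-< 2 t l (ℕ.<-≤-trans t< k≤2l))

  -- A polygon through all blue points with every red point outside: balance at the lower vertices.

  module Polygon (v : Fin #blues → Site)
    (v-blue : ∀ i → Blue (v i))
    (v-injective : ∀ {i j} → v i ≡ v j → i ≡ j)
    (v-surjective : ∀ {s} → Blue s → ∃ λ i → v i ≡ s)
    (simple : SimplePolygon (point ∘ v))
    (exterior : ∀ j → InExterior (point ∘ v) (R j)) where

    Adjacent : Site → Site → Set
    Adjacent a b = ∃ λ i → (v i ≡ a × v (csucc i) ≡ b) ⊎ (v i ≡ b × v (csucc i) ≡ a)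

    Adjacent-sym : ∀ {a b} → Adjacent a b → Adjacent b a
    Adjacent-sym (i , inj₁ e) = i , inj₂ e
    Adjacent-sym (i , inj₂ e) = i , inj₁ e

    Adjacent-next : ∀ i → Adjacent (v i) (v (csucc i))
    Adjacent-next i = i , inj₁ (refl , refl)

    Adjacent-prev : ∀ i → Adjacent (v i) (v (cpred i))
    Adjacent-prev i = cpred i , inj₂ (refl , cong v (csucc-cpred i))

    Adjacent-blue : ∀ {a b} → Adjacent a b → Blue a
    Adjacent-blue (i , inj₁ (refl , _)) = v-blue i
    Adjacent-blue (i , inj₂ (_ , refl)) = v-blue (csucc i)

    -- A simple polygon lets two edges meet only where one ends and the other starts; the last two
    -- inequalities exclude both ways.
    edges-disjoint : ∀ i j → v i ≢ v j → v (csucc i) ≢ v j → v i ≢ v (csucc j) →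
                     ∀ X → OnEdge (point ∘ v) i X → ¬ OnEdge (point ∘ v) j X
    edges-disjoint i j i≢j i⁺≢j i≢j⁺ X oni onj =
      [ (λ (j≡ , _) → i⁺≢j (cong v (sym j≡))) , (λ (i≡ , _) → i≢j⁺ (cong v i≡)) ]′
        (proj₂ simple i j (λ i≡j → i≢j (cong v i≡j)) X oni onj)

    Adjacent-disjoint : ∀ {a b c d} → Adjacent a b → Adjacent c d → a ≢ c → a ≢ d → b ≢ c → b ≢ d →
                        ¬ ∃ λ X → OnSeg (point a) (point b) X × OnSeg (point c) (point d) X
    Adjacent-disjoint (i , inj₁ (refl , refl)) (j , inj₁ (refl , refl)) a≢c a≢d b≢c b≢d (X , onab , oncd) =
      edges-disjoint i j a≢c b≢c a≢d X onab oncd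
    Adjacent-disjoint (i , inj₁ (refl , refl)) (j , inj₂ (refl , refl)) a≢c a≢d b≢c b≢d (X , onab , oncd) =
      edges-disjoint i j a≢d b≢d a≢c X onab (OnSeg-sym (point (v (csucc j))) (point (v j)) X oncd)
    Adjacent-disjoint (i , inj₂ (refl , refl)) (j , inj₁ (refl , refl)) a≢c a≢d b≢c b≢d (X , onab , oncd) =
      edges-disjoint i j b≢c a≢c b≢d X (OnSeg-sym (point (v (csucc i))) (point (v i)) X onab) oncd
    Adjacent-disjoint (i , inj₂ (refl , refl)) (j , inj₂ (refl , refl)) a≢c a≢d b≢c b≢d (X , onab , oncd) =
      edges-disjoint i j b≢d a≢d b≢c X (OnSeg-sym (point (v (csucc i))) (point (v i)) X onab)
        (OnSeg-sym (point (v (csucc j))) (point (v j)) X oncd)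

    flow-red : ∀ {j} → j < #reds → flow (isLowerEast (abscissa (red j)) ∘ v) (isUpper ∘ v) ≡ 0ℤ
    flow-red {j} j< = trans (sumZ-cong (λ i → sym (crossing-red j< (v-blue i) (v-blue (csucc i)))))
      (subst (λ h → winding (point ∘ v) (point (red h)) ≡ 0ℤ) (Fin.toℕ-fromℕ< j<) (proj₂ (exterior (Fin.fromℕ< j<))))

    isLower : Site → ℤ
    isLower s = 1ℤ ℤ.- isUpper s

    isLower-lower : ∀ {s} → Lower s → isLower s ≡ 1ℤ
    isLower-lower L = cong (λ z → 1ℤ ℤ.- z) (isUpper-lower L)

    lower-beyond-west : ∀ {s} → Lower s → s ≢ west → abscissa (red 0) < abscissa s
    lower-beyond-west west ≢west = contradiction refl ≢west
    lower-beyond-west east _ = s≤s (ℕ.+-monoʳ-< #tops (s≤s z≤n))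
    lower-beyond-west low  _ = s≤s (ℕ.+-monoʳ-< #tops (s≤s z≤n))

    lower-before-east : ∀ {s} → Blue s → Lower s → s ≢ east → ¬ abscissa (red l) < abscissa s
    lower-before-east _ west _ ()
    lower-before-east _ east ≢east = contradiction refl ≢east
    lower-before-east (low t<) low _ = ℕ.≤⇒≯ (s≤s (ℕ.+-monoʳ-≤ #tops (ℕ.≤-trans t< k≤2l)))

    -- The abscissae of `red t`, `low t` and `red (suc t)` are consecutive integers, so a blue point
    -- east of the first and different from the second is past the third.
    lower-gap : ∀ {s t} → Blue s → Blue (low t) → suc t < #reds → s ≢ low t →
                abscissa (red t) < abscissa s → abscissa (red (suc t)) < abscissa s
    lower-gap {s} {t} bs bl t< s≢low red<s = ℕ.≤∧≢⇒<
      (subst (_≤ abscissa s) (cong suc (sym (ℕ.+-suc #tops (suc (t * 2)))))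
      (ℕ.≤∧≢⇒< (subst (_≤ abscissa s) (cong suc (sym (ℕ.+-suc #tops (t * 2)))) red<s) λ eq → s≢low
        (sym (abscissa-injective (blue bl) (blue bs) eq))))
      λ eq → lower≢red bs t< (sym eq)

    balanced-at : ∀ p (f f′ : Site → ℤ) → flow (f ∘ v) (isUpper ∘ v) ≡ 0ℤ → flow (f′ ∘ v) (isUpper ∘ v) ≡ 0ℤ →
                  (∀ {s} → Blue s → s ≢ v p → f s ≡ f′ s) → f (v p) ≡ 1ℤ ℤ.+ f′ (v p) →
                  isUpper (v (csucc p)) ≡ isUpper (v (cpred p))
    balanced-at p f f′ z z′ off at = flow-isolates (f ∘ v) (f′ ∘ v) (isUpper ∘ v) p z z′
      (λ i i≢p → off (v-blue i) (λ eq → i≢p (v-injective eq))) at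

    -- Two indicators of lower vertices with vanishing flow differ only at `v p`. For `low t` they
    -- belong to the red points on its two sides; for `west` one of them counts all lower vertices,
    -- and for `east` one counts none.
    balanced : ∀ p {s} → v p ≡ s → Lower s → isUpper (v (csucc p)) ≡ isUpper (v (cpred p))
    balanced p {west} vp≡ west = balanced-at p isLower (isLowerEast (abscissa (red 0)))
      (flow-complement (isLower ∘ v) (isUpper ∘ v) λ _ → refl) (flow-red (s≤s z≤n)) off at
      where
      off : ∀ {s} → Blue s → s ≢ v p → isLower s ≡ isLowerEast (abscissa (red 0)) s
      off bs s≢ = [ (λ L → trans (isLower-lower L)
        (sym (lower-east L (lower-beyond-west L (λ e → s≢ (trans e (sym vp≡)))))))
                  , (λ U → trans (cong (λ z → 1ℤ ℤ.- z) (isUpper-upper U)) (sym (isLowerEast-upper U))) ]′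
                    (lower-or-upper bs)
      at : isLower (v p) ≡ 1ℤ ℤ.+ isLowerEast (abscissa (red 0)) (v p)
      at = subst (λ s → isLower s ≡ 1ℤ ℤ.+ isLowerEast (abscissa (red 0)) s) (sym vp≡) refl
    balanced p {east} vp≡ east = balanced-at p (isLowerEast (abscissa (red l))) (λ _ → 0ℤ)
      (flow-red (ℕ.n<1+n l)) (sumZ-0 #blues λ i → refl) off at
      where
      off : ∀ {s} → Blue s → s ≢ v p → isLowerEast (abscissa (red l)) s ≡ 0ℤ
      off bs s≢ = [ (λ L → lower-west L (lower-before-east bs L (λ e → s≢ (trans e (sym vp≡))))) , isLowerEast-upper
        ]′ (lower-or-upper bs)
      at : isLowerEast (abscissa (red l)) (v p) ≡ 1ℤ
      at = trans (cong (isLowerEast (abscissa (red l))) vp≡) (lower-east east (abscissa<width (red (ℕ.n<1+n l)) λ ()))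
    balanced p {low t} vp≡ low = balanced-at p (isLowerEast (abscissa (red t))) (isLowerEast (abscissa (red (suc t))))
        (flow-red (ℕ.<-trans (ℕ.n<1+n t) 1+t<)) (flow-red 1+t<) off at
      where
      bl : Blue (low t)
      bl = subst Blue vp≡ (v-blue p)
      1+t< : suc t < #reds
      1+t< = low⇒red bl
      red<red : abscissa (red t) < abscissa (red (suc t))
      red<red = s≤s (ℕ.+-monoʳ-< #tops (ℕ.*-monoˡ-< 2 (ℕ.n<1+n t)))
      lower : ∀ {s} → Blue s → s ≢ v p → Lower s → Dec (abscissa (red t) < abscissa s) →
              isLowerEast (abscissa (red t)) s ≡ isLowerEast (abscissa (red (suc t))) s
      lower bs s≢ L (yes lt) = trans (lower-east L lt)
        (sym (lower-east L (lower-gap bs bl 1+t< (λ e → s≢ (trans e (sym vp≡))) lt)))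
      lower bs s≢ L (no nlt) = trans (lower-west L nlt) (sym (lower-west L λ lt → nlt (ℕ.<-trans red<red lt)))
      off : ∀ {s} → Blue s → s ≢ v p → isLowerEast (abscissa (red t)) s ≡ isLowerEast (abscissa (red (suc t))) s
      off {s} bs s≢ = [ (λ L → lower bs s≢ L (abscissa (red t) ℕ.<? abscissa s))
                      , (λ U → trans (isLowerEast-upper U) (sym (isLowerEast-upper U))) ]′ (lower-or-upper bs)
      at : isLowerEast (abscissa (red t)) (v p) ≡ 1ℤ ℤ.+ isLowerEast (abscissa (red (suc t))) (v p)
      at = trans (cong (isLowerEast (abscissa (red t))) vp≡)
        (trans (lower-east {s = low t} low (s≤s (ℕ.+-monoʳ-< #tops (ℕ.n<1+n (t * 2)))))
        (cong (λ z → 1ℤ ℤ.+ z) (sym (trans (cong (isLowerEast (abscissa (red (suc t)))) vp≡)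
          (lower-west {s = low t} low (ℕ.<⇒≯ (s≤s (ℕ.+-monoʳ-< #tops (ℕ.n<1+n (suc (t * 2)))))))))))

    1≢0 : 1ℤ ≢ 0ℤ
    1≢0 ()

    isUpper≡1 : ∀ {s} → Blue s → isUpper s ≡ 1ℤ → Upper s
    isUpper≡1 bs eq = [ (λ L → contradiction (trans (sym eq) (isUpper-lower L)) 1≢0) , (λ U → U) ]′ (lower-or-upper bs)

    isUpper≡0 : ∀ {s} → Blue s → isUpper s ≡ 0ℤ → Lower s
    isUpper≡0 bs eq = [ (λ L → L) , (λ U → contradiction (trans (sym (isUpper-upper U)) eq) 1≢0) ]′ (lower-or-upper bs)

    -- If a lower vertex were followed by a lower one, balance at the second would make the third
    -- lower, and so on around the polygon, which however contains `top 0`.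
    next-upper : ∀ p → Lower (v p) → Upper (v (csucc p))
    next-upper p L = [ (λ L′ → contradiction (proj₁ (all-lower L′ (proj₁ a-top)))
      (subst (λ s → ¬ Lower s) (sym (proj₂ a-top)) λ ())) , (λ U → U) ]′
                       (lower-or-upper (v-blue (csucc p)))
      where
      a-top : ∃ λ i → v i ≡ top 0
      a-top = v-surjective (top (s≤s z≤n))
      all-lower : Lower (v (csucc p)) → ∀ i → Lower (v i) × Lower (v (csucc i))
      all-lower L′ = csucc-closed (λ i → Lower (v i) × Lower (v (csucc i)))
        (λ i (Li , Li′) → Li′ , isUpper≡0 (v-blue (csucc (csucc i)))
          (trans (balanced (csucc i) refl Li′) (trans (cong (isUpper ∘ v) (cpred-csucc i)) (isUpper-lower Li)))) {p}
            (L , L′)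

    prev-upper : ∀ p → Lower (v p) → Upper (v (cpred p))
    prev-upper p L = isUpper≡1 (v-blue (cpred p)) (trans (sym (balanced p refl L)) (isUpper-upper (next-upper p L)))

    -- Hull chords at `west`, and the climb along the lower vertices.

    data Fan (c : ℕ) : Site → Set where
      west : Fan c west
      top  : ∀ {d} → d ≤ c → Fan c (top d)

    fan-or-beyond : ∀ c {s} → Blue s → Fan c s ⊎ Beyond c s
    fan-or-beyond c west    = inj₁ west
    fan-or-beyond c east    = inj₂ east
    fan-or-beyond c (low _) = inj₂ low
    fan-or-beyond c (mid _) = inj₂ mid
    fan-or-beyond c (top {d} _) = [ (λ c<d → inj₂ (top c<d)) , (λ d≤c → inj₁ (top d≤c)) ]′ (ℕ.<-≤-connex c d)

    -- From a top strictly inside the fan, an edge to a site beyond it would cross the chord.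
    fan-closed : ∀ {j c y} → Adjacent west (top c) → Adjacent (top j) y → j < c → Blue (top j) → Blue (top c) →
      Blue y → Fan c y
    fan-closed {j} {c} {y} chord jy j<c bj bc by = [ (λ fan → fan) , (λ beyond → ⊥-elim
        (Adjacent-disjoint chord jy (λ ()) (west≢ beyond) (λ { refl → ℕ.<-irrefl refl j<c }) (top≢ beyond)
          (chord-crossing j<c bj bc by beyond))) ]′ (fan-or-beyond c by)
      where
      west≢ : ∀ {y} → Beyond c y → west ≢ y
      west≢ () refl
      top≢ : ∀ {y} → Beyond c y → top c ≢ y
      top≢ (top c<c) refl = ℕ.<-irrefl refl c<c

    -- The chord from west to top c separates the tops below c from everything beyond, so a
    -- polygon through the chord that enters the fan next to west on the other side stays in it.
    module _ {p c d} (vp≡west : v p ≡ west) (d<c : d < c) (step back : Fin #blues → Fin #blues)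
      (adjacent : ∀ i → Adjacent (v i) (v (step i))) (step-back : step (back p) ≡ p)
      (v-step : v (step p) ≡ top d) (v-back : v (back p) ≡ top c) where

      fan-step : ∀ i → Fan c (v i) → Fan c (v (step i))
      fan-step i fan = cases fan refl
        where
        cases : ∀ {s} → Fan c s → v i ≡ s → Fan c (v (step i))
        -- At `west` the walk takes the edge other than the chord, to `top d`.
        cases west eq = subst (Fan c) (sym (trans (cong (v ∘ step) (v-injective (trans eq (sym vp≡west)))) v-step))
          (top (ℕ.<⇒≤ d<c))
        cases (top {e} e≤c) eq = [ (λ e<c → fan-closed chord (subst (λ s → Adjacent s (v (step i))) eq (adjacent i)) e<c
                                        (subst Blue eq (v-blue i)) (subst Blue v-back (v-blue (back p)))
                                          (v-blue (step i)))
                                 -- At `top c` the walk returns along the chord to `west`.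
                                 , (λ { refl → subst (Fan c)
                                   (sym (trans (cong v
                                     (trans (cong step (v-injective (trans eq (sym v-back)))) step-back)) vp≡west))
                                       west }) ]′
                                 (ℕ.m≤n⇒m<n∨m≡n e≤c)
          where
          chord : Adjacent west (top c)
          chord = Adjacent-sym (subst₂ Adjacent v-back (trans (cong v step-back) vp≡west) (adjacent (back p)))

    fan∌east : ∀ {c} → ¬ Fan c east
    fan∌east ()

    -- The neighbour of larger index spans the chord and the walk starts towards the other one,
    -- forwards or backwards accordingly; confined to the fan, it would never visit `east`.
    no-chord : ∀ {p c d} → v p ≡ west → v (csucc p) ≡ top c → ¬ v (cpred p) ≡ top d
    no-chord {p} {c} {d} vp≡ next prev = cases (ℕ.<-cmp c d)
      where
      i = proj₁ (v-surjective east)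
      vi≡ = proj₂ (v-surjective east)
      cases : ¬ Tri (c < d) (c ≡ d) (d < c)
      cases (tri< c<d _ _) = fan∌east (subst (Fan d) vi≡ (csucc-closed (Fan d ∘ v)
        (fan-step vp≡ c<d csucc cpred Adjacent-next (csucc-cpred p) next prev) {p} (subst (Fan d) (sym vp≡) west) i))
      cases (tri≈ _ refl _) = csucc≢cpred p (v-injective (trans next (sym prev)))
      cases (tri> _ _ d<c) = fan∌east (subst (Fan c) vi≡ (cpred-closed (Fan c ∘ v)
        (fan-step vp≡ d<c cpred csucc Adjacent-prev (cpred-csucc p) prev next) {p} (subst (Fan c) (sym vp≡) west) i))

    -- The invariant of the induction; `j ≤ t` records that the first `j` mids are already used up.
    Climb : ℕ → Set
    Climb j = ∃ λ t → j ≤ t × Blue (mid t) × Adjacent (stair j) (mid t)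

    climb-zero : Climb 0
    climb-zero = go refl refl (next-upper p L) (prev-upper p L)
      where
      p = proj₁ (v-surjective west)
      vp≡ = proj₂ (v-surjective west)
      L : Lower (v p)
      L = subst Lower (sym vp≡) west
      go : ∀ {s s′} → v (csucc p) ≡ s → v (cpred p) ≡ s′ → Upper s → Upper s′ → Climb 0
      go next prev (mid {t}) _ = t , z≤n , subst Blue next (v-blue (csucc p)) , subst₂ Adjacent vp≡ next
        (Adjacent-next p)
      go next prev top (mid {t}) = t , z≤n , subst Blue prev (v-blue (cpred p)) , subst₂ Adjacent vp≡ prev
        (Adjacent-prev p)
      go next prev top top = contradiction prev (no-chord vp≡ next)

    -- If `u` were a top or a mid before `mid t`, its edge to `low j` would cross the edge from
    -- `stair j` to `mid t`.
    stair-monotone : ∀ {j t u} → Blue (stair j) → Blue (mid t) → Blue (low j) → Blue u → Upper u →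
                     Adjacent (stair j) (mid t) → Adjacent (low j) u → ∃ λ s → u ≡ mid s × t ≤ s
    stair-monotone {j} {t} {u} ba bw bb bu U at bu-adj = cases U refl
      where
      impossible : u ≺ mid t → u ≢ mid t → ⊥
      impossible u≺w u≢w = Adjacent-disjoint (Adjacent-sym bu-adj) (Adjacent-sym at) u≢w
        (upper≢lower U (stair-lower j)) (λ ()) (low≢stair j)
        (stair-crossing u≺w bu bw ba bb (stair-lower j) low (stair-ascends j) (low<mid bb))
        where
        upper≢lower : ∀ {u s} → Upper u → Lower s → u ≢ s
        upper≢lower top () refl
        upper≢lower mid () refl
        low≢stair : ∀ j → low j ≢ stair j
        low≢stair zero    ()
        low≢stair (suc j) ()
      cases : ∀ {s} → Upper s → u ≡ s → ∃ λ s → u ≡ mid s × t ≤ s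
      cases top refl = ⊥-elim (impossible top≺mid λ ())
      cases (mid {s}) refl = [ (λ s<t → ⊥-elim (impossible (mid≺mid s<t) λ { refl → ℕ.<-irrefl refl s<t })) ,
        (λ t≤s → s , refl , t≤s) ]′ (ℕ.<-≤-connex s t)

    -- Both neighbours of `low j` are mids of index at least `t`; being distinct, one of them has a
    -- larger index.
    climb-suc : ∀ {j} → Climb j → Climb (suc j)
    climb-suc {j} (t , j≤t , bw@(mid 1+2t<k) , adj) =
      go (step (csucc p) (next-upper p L) (Adjacent-next p)) (step (cpred p) (prev-upper p L) (Adjacent-prev p))
      where
      -- The existence of `mid t` with `j ≤ t` gives `j * 2 < k`, so `low j` is among the blue
      -- points.
      low-found = v-surjective {low j} (low (ℕ.≤-<-trans (ℕ.*-monoˡ-≤ 2 j≤t) (ℕ.<-trans (ℕ.n<1+n (t * 2)) 1+2t<k)))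
      p = proj₁ low-found
      vp≡ = proj₂ low-found
      L : Lower (v p)
      L = subst Lower (sym vp≡) low
      bl : Blue (low j)
      bl = subst Blue vp≡ (v-blue p)
      bs : Blue (stair j)
      bs = Adjacent-blue adj
      step : ∀ i → Upper (v i) → Adjacent (v p) (v i) → ∃ λ s → v i ≡ mid s × t ≤ s
      step i U a = stair-monotone bs bw bl (v-blue i) U adj (subst (λ s → Adjacent s (v i)) vp≡ a)
      arrive : ∀ i {s} → v i ≡ mid s → t < s → Adjacent (v p) (v i) → Climb (suc j)
      arrive i {s} vi≡ t<s a = s , ℕ.≤-<-trans j≤t t<s , subst Blue vi≡ (v-blue i) , subst₂ Adjacent vp≡ vi≡ a
      go : (∃ λ s → v (csucc p) ≡ mid s × t ≤ s) → (∃ λ s → v (cpred p) ≡ mid s × t ≤ s) → Climb (suc j)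
      go (s , next , t≤s) (s′ , prev , t≤s′) =
        [ (λ t<s → arrive (csucc p) next t<s (Adjacent-next p))
        -- Here the next vertex is `mid t` itself, so the previous one, being different, lies
        -- strictly beyond it.
        , (λ { refl → arrive (cpred p) prev (ℕ.≤∧≢⇒< t≤s′
          λ { refl → csucc≢cpred p (v-injective (trans next (sym prev))) }) (Adjacent-prev p) }) ]′
        (ℕ.m≤n⇒m<n∨m≡n t≤s)

    climb : ∀ j → Climb j
    climb zero    = climb-zero
    climb (suc j) = climb-suc (climb j)

    impossible : ⊥
    -- At height `k` a mid would satisfy both `k ≤ t` and `suc (t * 2) < k`.
    impossible = absurd (climb k)
      where
      absurd : ¬ Climb k
      absurd (t , k≤t , mid 1+2t<k , _) = ℕ.<-irrefl refl
        (ℕ.<-trans (ℕ.≤-<-trans (ℕ.≤-trans k≤t (ℕ.m≤m*n t 2)) (ℕ.n<1+n (t * 2))) 1+2t<k)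

theorem10 : (n l k : ℕ) → 3 ≤ n → 1 ≤ l → k ≤ 2 * l ∸ 2 →
    Σ (Fin (suc (n ∸ 1 + k)) → Point) λ B →
    Σ (Fin l → Point) λ R →
    Injective _≡_ _≡_ (B ++ R) ×
    GeneralPosition (B ++ R) ×
    (∀ i → IsHullVertex (B ++ R) (B i) ⇔ toℕ i < n) ×
    (∀ j → ¬ IsHullVertex (B ++ R) (R j)) ×
    (∀ (σ : Permutation′ (suc (n ∸ 1 + k))) →
    ¬ (SimplePolygon (λ i → B (σ ⟨$⟩ʳ i)) ×
    (∀ j → InExterior (λ i → B (σ ⟨$⟩ʳ i)) (R j))))
theorem10 (suc (suc (suc n))) (suc l) k (s≤s (s≤s (s≤s z≤n))) (s≤s z≤n) k≤2l =
  C.B , C.R , C.B++R-injective , C.generalPosition , C.hullVertices , C.redsInside ,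
  λ σ (simple , exterior) → C.Polygon.impossible (λ i → C.site (toℕ (σ ⟨$⟩ʳ i)))
    (λ i → C.blue-site (toℕ (σ ⟨$⟩ʳ i)) (Fin.toℕ<n (σ ⟨$⟩ʳ i))) (injective σ) (surjective σ) simple exterior
  where
  -- After commuting the product, `suc l * 2 ∸ 2` computes to `l * 2`.
  module C = Configuration n l k (subst (k ≤_) (cong (_∸ 2) (ℕ.*-comm 2 (suc l))) k≤2l)

  injective : ∀ (σ : Permutation′ C.#blues) {i j} → C.site (toℕ (σ ⟨$⟩ʳ i)) ≡ C.site (toℕ (σ ⟨$⟩ʳ j)) → i ≡ j
  injective σ {i} {j} eq = trans (sym (inverseˡ σ)) (trans (cong (σ ⟨$⟩ˡ_) (Fin.toℕ-injective
    (trans (sym (C.index-site _)) (trans (cong C.index eq) (C.index-site _))))) (inverseˡ σ))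

  surjective : ∀ (σ : Permutation′ C.#blues) {s} → C.Blue s → ∃ λ i → C.site (toℕ (σ ⟨$⟩ʳ i)) ≡ s
  surjective σ b = σ ⟨$⟩ˡ Fin.fromℕ< (C.index<#blues b) ,
    trans (cong (C.site ∘ toℕ) (inverseʳ σ)) (trans (cong C.site (Fin.toℕ-fromℕ< (C.index<#blues b))) (C.site-index b))
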